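{- Let $n$ be a positive integer and let $\alpha,\beta,\gamma,\delta$ be distinct complex numbers satisfying $(\alpha+\beta)(\gamma+\delta)=2(\alpha\beta+\gamma\delta)$. Then $$\lim_{k\to\alpha}\frac{d^n}{dk^n}\,\frac{(k-\gamma)^n(k-\delta)^n}{(k-\beta)^{n+1}}=\begin{cases}0 & n\text{ odd},\\[4pt] (-1)^{n/2}\dfrac{(\gamma-\delta)^n}{(\alpha-\beta)^{n+1}}\,\prod_{i=1}^{n/2}(2i-1)^2 & n\text{ even}.\end{cases}$$ -}

module Defs where

open import Level as Level using (_⊔_)
open import Algebra.Bundles using (CommutativeRing; CommutativeSemiring)
open import Algebra.Structures using (IsCommutativeRing)
open import Algebra.Apartness.Bundles using (HeytingCommutativeRing; HeytingField)
import Algebra.Apartness.Properties.HeytingCommutativeRing as HeytingCommutativeRingProperties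
import Algebra.Definitions as AlgebraDefinitions
import Algebra.Properties.Ring as RingProperties
import Algebra.Properties.Semiring.Exp as SemiringExp
import Algebra.Properties.Semiring.Mult as SemiringMult
import Algebra.Solver.Ring.NaturalCoefficients.Default as Solver
open import Data.Empty using (⊥-elim)
open import Data.Nat.Base as ℕ using (ℕ)
open import Data.Product.Base using (∃; _×_; _,_; proj₁; proj₂)
open import Data.Sum.Base as Sum using (_⊎_; inj₁; inj₂)
open import Function.Base using (_∘_)
open import Relation.Binary.Core using (Rel)
open import Relation.Binary.Structures using (IsStrictPartialOrder)
import Relation.Binary.Reasoning.Setoid as SetoidReasoning
open import Relation.Nullary.Negation using (¬_)

module FieldOperations {c ℓ₁ ℓ₂} (F : HeytingField c ℓ₁ ℓ₂) where

  open HeytingField F public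
  open HeytingCommutativeRing heytingCommutativeRing public using (commutativeRing)
  open CommutativeRing commutativeRing public
    using (ring; semiring; commutativeSemiring)
  open SemiringExp semiring public using (_^_)
  open HeytingCommutativeRingProperties heytingCommutativeRing public
    using (x-0≈x; 1#0; x#0y#0→xy#0; #-congʳ; #-congˡ; invertibleˡ⇒#)

  fromℕ : ℕ → Carrier
  fromℕ m = SemiringMult._×_ semiring m 1#

  opaque
    x#y⇒x-y#0 : ∀ {x y} → x # y → x - y # 0#
    x#y⇒x-y#0 x#y with #⇒invertible x#y
    ... | t , t*[x-y]≈1 , _ = invertibleˡ⇒# (t , trans (*-congˡ (x-0≈x _)) t*[x-y]≈1)

    x-y#0⇒x#y : ∀ {x y} → x - y # 0# → x # y
    x-y#0⇒x#y x-y#0 with #⇒invertible x-y#0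
    ... | t , t*[x-y-0]≈1 , _ = invertibleˡ⇒# (t , trans (*-congˡ (sym (x-0≈x _))) t*[x-y-0]≈1)

    xy#0⇒y#0 : ∀ {x y} → x * y # 0# → y # 0#
    xy#0⇒y#0 {x} {y} xy#0 with #⇒invertible xy#0
    ... | t , t*[xy-0]≈1 , _ = invertibleˡ⇒# (t * x , (begin
      t * x * (y - 0#)   ≈⟨ *-congˡ (x-0≈x y) ⟩
      t * x * y          ≈⟨ *-assoc t x y ⟩
      t * (x * y)        ≈⟨ *-congˡ (x-0≈x (x * y)) ⟨
      t * (x * y - 0#)   ≈⟨ t*[xy-0]≈1 ⟩
      1#                 ∎))
      where open SetoidReasoning setoid

    x^n#0 : ∀ {x} → x # 0# → ∀ n → x ^ n # 0#
    x^n#0 x#0 ℕ.zero    = 1#0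
    x^n#0 x#0 (ℕ.suc n) = x#0y#0→xy#0 x#0 (x^n#0 x#0 n)

    -- The library provides an inverse of x - y for x # y; take y to be 0#.
    inverse : ∀ x → x # 0# → Carrier
    inverse x x#0 = proj₁ (#⇒invertible x#0)

    inverseʳ : ∀ x (x#0 : x # 0#) → x * inverse x x#0 ≈ 1#
    inverseʳ x x#0 = trans (*-congʳ (sym (x-0≈x x))) (proj₂ (proj₂ (#⇒invertible x#0)))

  infixl 7 _/_⟨_⟩
  _/_⟨_⟩ : ∀ (x y : Carrier) → y # 0# → Carrier
  x / y ⟨ y#0 ⟩ = x * inverse y y#0

-- The real numbers up to isomorphism: a Cauchy complete Archimedean ordered
-- field. Being apart means being comparable, so classically # is ≉; stated with
-- apartness, the axioms also hold of the constructive (Bishop) reals.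
record RealField c ℓ₁ ℓ₂ ℓ₃ : Set (Level.suc (c ⊔ ℓ₁ ⊔ ℓ₂ ⊔ ℓ₃)) where
  infix 4 _<_ ∣_-_∣<_
  field
    heytingField : HeytingField c ℓ₁ ℓ₂

  open FieldOperations heytingField public

  field
    _<_                  : Rel Carrier ℓ₃
    isStrictPartialOrder : IsStrictPartialOrder _≈_ _<_
    <⇒#                  : ∀ {x y} → x < y → x # y
    #⇒<⊎>                : ∀ {x y} → x # y → x < y ⊎ y < x
    +-monoʳ-<            : ∀ z {x y} → x < y → z + x < z + y
    *-positive           : ∀ {x y} → 0# < x → 0# < y → 0# < x * y
    archimedean          : ∀ x → ∃ λ n → x < fromℕ n

  ∣_-_∣<_ : Carrier → Carrier → Carrier → Set ℓ₃
  ∣ x - y ∣< ε = x - y < ε × y - x < ε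

  IsCauchy : (ℕ → Carrier) → Set (c ⊔ ℓ₃)
  IsCauchy s = ∀ ε → 0# < ε → ∃ λ N → ∀ m n → N ℕ.≤ m → N ℕ.≤ n → ∣ s m - s n ∣< ε

  ConvergesTo : (ℕ → Carrier) → Carrier → Set (c ⊔ ℓ₃)
  ConvergesTo s l = ∀ ε → 0# < ε → ∃ λ N → ∀ n → N ℕ.≤ n → ∣ s n - l ∣< ε

  field
    complete : ∀ s → IsCauchy s → ∃ λ l → ConvergesTo s l

module RealProperties {c ℓ₁ ℓ₂ ℓ₃} (ℝ : RealField c ℓ₁ ℓ₂ ℓ₃) where

  open RealField ℝ
  open IsStrictPartialOrder isStrictPartialOrder
    using (<-respˡ-≈; <-respʳ-≈) renaming (irrefl to <-irrefl; trans to <-trans)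
  open RingProperties ring using (-‿distribˡ-*; -‿distribʳ-*; -‿involutive)

  <-cotrans : ∀ {x y} → x < y → ∀ z → x < z ⊎ z < y
  <-cotrans x<y z with #-cotrans (<⇒# x<y) z
  ... | inj₁ x#z = Sum.map₂ (λ z<x → <-trans z<x x<y) (#⇒<⊎> x#z)
  ... | inj₂ z#y with #⇒<⊎> z#y
  ...   | inj₁ z<y = inj₂ z<y
  ...   | inj₂ y<z = inj₁ (<-trans x<y y<z)

  [-x][-x]≈xx : ∀ x → (- x) * (- x) ≈ x * x
  [-x][-x]≈xx x = trans (sym (-‿distribˡ-* x (- x)))
    (trans (-‿cong (sym (-‿distribʳ-* x x))) (-‿involutive (x * x)))

  x#0⇒0<xx : ∀ {x} → x # 0# → 0# < x * x
  x#0⇒0<xx {x} x#0 with #⇒<⊎> x#0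
  ... | inj₂ 0<x = *-positive 0<x 0<x
  ... | inj₁ x<0 = <-respʳ-≈ ([-x][-x]≈xx x) (*-positive 0<-x 0<-x)
    where
    0<-x : 0# < - x
    0<-x = <-respˡ-≈ (-‿inverseˡ x) (<-respʳ-≈ (+-identityʳ (- x)) (+-monoʳ-< (- x) x<0))

  xx≮0 : ∀ {x} → ¬ x * x < 0#
  xx≮0 xx<0 = <-irrefl refl (<-trans xx<0 (x#0⇒0<xx (xy#0⇒y#0 (<⇒# xx<0))))

  x#0⇒0<xx+yy : ∀ {x} y → x # 0# → 0# < x * x + y * y
  x#0⇒0<xx+yy {x} y x#0 with <-cotrans (x#0⇒0<xx x#0) (x * x + y * y)
  ... | inj₁ 0<xx+yy = 0<xx+yy
  ... | inj₂ xx+yy<xx = ⊥-elim (xx≮0 yy<0)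
    where
    cancel : - (x * x) + (x * x + y * y) ≈ y * y
    cancel = trans (sym (+-assoc _ _ _)) (trans (+-congʳ (-‿inverseˡ _)) (+-identityˡ _))
    yy<0 : y * y < 0#
    yy<0 = <-respˡ-≈ cancel (<-respʳ-≈ (-‿inverseˡ _) (+-monoʳ-< (- (x * x)) xx+yy<xx))

  xx+yy#0 : ∀ {x y} → x # 0# ⊎ y # 0# → x * x + y * y # 0#
  xx+yy#0 {y = y} (inj₁ x#0) = #-sym (<⇒# (x#0⇒0<xx+yy y x#0))
  xx+yy#0 {x = x} (inj₂ y#0) =
    #-sym (<⇒# (<-respʳ-≈ (+-comm _ _) (x#0⇒0<xx+yy x y#0)))

-- The ring laws of pairs (a , b) = a + b i only need i * i to be some constant e.
-- Kept over an abstract semiring, where the solver is fast.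
private module PairIdentities {c ℓ} (R : CommutativeSemiring c ℓ) where

  open CommutativeSemiring R
  open Solver R using (solve; _:+_; _:*_; _:=_)

  *-assoc-re : ∀ e a b c d x y →
    (a * c + e * (b * d)) * x + e * ((a * d + b * c) * y) ≈
    a * (c * x + e * (d * y)) + e * (b * (c * y + d * x))
  *-assoc-re = solve 7 (λ e a b c d x y →
    (a :* c :+ e :* (b :* d)) :* x :+ e :* ((a :* d :+ b :* c) :* y) :=
    a :* (c :* x :+ e :* (d :* y)) :+ e :* (b :* (c :* y :+ d :* x))) refl

  *-assoc-im : ∀ e a b c d x y →
    (a * c + e * (b * d)) * y + (a * d + b * c) * x ≈
    a * (c * y + d * x) + b * (c * x + e * (d * y))
  *-assoc-im = solve 7 (λ e a b c d x y →
    (a :* c :+ e :* (b :* d)) :* y :+ (a :* d :+ b :* c) :* x :=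
    a :* (c :* y :+ d :* x) :+ b :* (c :* x :+ e :* (d :* y))) refl

  distribˡ-re : ∀ e a b c d x y →
    a * (c + x) + e * (b * (d + y)) ≈
    (a * c + e * (b * d)) + (a * x + e * (b * y))
  distribˡ-re = solve 7 (λ e a b c d x y →
    a :* (c :+ x) :+ e :* (b :* (d :+ y)) :=
    (a :* c :+ e :* (b :* d)) :+ (a :* x :+ e :* (b :* y))) refl

  distribˡ-im : ∀ a b c d x y →
    a * (d + y) + b * (c + x) ≈ (a * d + b * c) + (a * y + b * x)
  distribˡ-im = solve 6 (λ a b c d x y →
    a :* (d :+ y) :+ b :* (c :+ x) :=
    (a :* d :+ b :* c) :+ (a :* y :+ b :* x)) refl

  swap : ∀ x y z → x * (y * z) ≈ y * (x * z)
  swap = solve 3 (λ x y z → x :* (y :* z) := y :* (x :* z)) refl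

module ComplexField {c ℓ₁ ℓ₂ ℓ₃} (ℝ : RealField c ℓ₁ ℓ₂ ℓ₃) where

  private
    module ℝ where
      open RealField ℝ public
      open RealProperties ℝ public
      open RingProperties ring public
        using (-‿distribˡ-*; -‿distribʳ-*; -‿involutive; -1*x≈-x)

  open ℝ using (_+_; _*_; _-_; -_; 0#; 1#; _≈_; _#_)

  record ℂ : Set c where
    constructor _+i_
    field
      re im : ℝ.Carrier
  open ℂ public

  infix 4 _≈ᶜ_ _#ᶜ_
  _≈ᶜ_ : Rel ℂ ℓ₁
  z ≈ᶜ w = re z ≈ re w × im z ≈ im w

  _#ᶜ_ : Rel ℂ ℓ₂
  z #ᶜ w = re z # re w ⊎ im z # im w

  infixl 6 _+ᶜ_
  infixl 7 _*ᶜ_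
  infix  8 -ᶜ_
  _+ᶜ_ _*ᶜ_ : ℂ → ℂ → ℂ
  (a +i b) +ᶜ (c +i d) = (a + c) +i (b + d)
  (a +i b) *ᶜ (c +i d) = (a * c - b * d) +i (a * d + b * c)

  -ᶜ_ : ℂ → ℂ
  -ᶜ (a +i b) = (- a) +i (- b)

  0ᶜ 1ᶜ : ℂ
  0ᶜ = 0# +i 0#
  1ᶜ = 1# +i 0#

  private
    module Pair = PairIdentities ℝ.commutativeSemiring
    open SetoidReasoning ℝ.setoid

    e : ℝ.Carrier
    e = - 1#

    sub : ∀ {x y} → x - y ≈ x + e * y
    sub = ℝ.+-congˡ (ℝ.sym (ℝ.-1*x≈-x _))

    *-assoc-re : ∀ a b c d x y →
      (a * c - b * d) * x - (a * d + b * c) * y ≈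
      a * (c * x - d * y) - b * (c * y + d * x)
    *-assoc-re a b c d x y = begin
      (a * c - b * d) * x - (a * d + b * c) * y
        ≈⟨ ℝ.trans sub (ℝ.+-congʳ (ℝ.*-congʳ sub)) ⟩
      (a * c + e * (b * d)) * x + e * ((a * d + b * c) * y)
        ≈⟨ Pair.*-assoc-re e a b c d x y ⟩
      a * (c * x + e * (d * y)) + e * (b * (c * y + d * x))
        ≈⟨ ℝ.trans sub (ℝ.+-congʳ (ℝ.*-congˡ sub)) ⟨
      a * (c * x - d * y) - b * (c * y + d * x) ∎

    *-assoc-im : ∀ a b c d x y →
      (a * c - b * d) * y + (a * d + b * c) * x ≈
      a * (c * y + d * x) + b * (c * x - d * y)
    *-assoc-im a b c d x y = begin
      (a * c - b * d) * y + (a * d + b * c) * x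
        ≈⟨ ℝ.+-congʳ (ℝ.*-congʳ sub) ⟩
      (a * c + e * (b * d)) * y + (a * d + b * c) * x
        ≈⟨ Pair.*-assoc-im e a b c d x y ⟩
      a * (c * y + d * x) + b * (c * x + e * (d * y))
        ≈⟨ ℝ.+-congˡ (ℝ.*-congˡ sub) ⟨
      a * (c * y + d * x) + b * (c * x - d * y) ∎

    distribˡ-re : ∀ a b c d x y →
      a * (c + x) - b * (d + y) ≈ (a * c - b * d) + (a * x - b * y)
    distribˡ-re a b c d x y = begin
      a * (c + x) - b * (d + y)
        ≈⟨ sub ⟩
      a * (c + x) + e * (b * (d + y))
        ≈⟨ Pair.distribˡ-re e a b c d x y ⟩
      (a * c + e * (b * d)) + (a * x + e * (b * y))
        ≈⟨ ℝ.+-cong sub sub ⟨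
      (a * c - b * d) + (a * x - b * y) ∎

    *ᶜ-comm : ∀ z w → z *ᶜ w ≈ᶜ w *ᶜ z
    *ᶜ-comm (a +i b) (c +i d) =
      ℝ.+-cong (ℝ.*-comm a c) (ℝ.-‿cong (ℝ.*-comm b d)) ,
      ℝ.trans (ℝ.+-comm _ _) (ℝ.+-cong (ℝ.*-comm b c) (ℝ.*-comm a d))

    -0≈0 : - 0# ≈ 0#
    -0≈0 = ℝ.trans (ℝ.sym (ℝ.+-identityˡ _)) (ℝ.-‿inverseʳ 0#)

    *ᶜ-identityˡ : ∀ z → 1ᶜ *ᶜ z ≈ᶜ z
    *ᶜ-identityˡ (a +i b) =
      ℝ.trans (ℝ.+-cong (ℝ.*-identityˡ a) (ℝ.trans (ℝ.-‿cong (ℝ.zeroˡ b)) -0≈0)) (ℝ.+-identityʳ a) ,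
      ℝ.trans (ℝ.+-cong (ℝ.*-identityˡ b) (ℝ.zeroˡ a)) (ℝ.+-identityʳ b)

    *ᶜ-distribˡ : ∀ z u v → z *ᶜ (u +ᶜ v) ≈ᶜ z *ᶜ u +ᶜ z *ᶜ v
    *ᶜ-distribˡ (a +i b) (c +i d) (x +i y) = distribˡ-re a b c d x y , Pair.distribˡ-im a b c d x y

    ≈ᶜ-trans : ∀ {u v w} → u ≈ᶜ v → v ≈ᶜ w → u ≈ᶜ w
    ≈ᶜ-trans (p , q) (p′ , q′) = ℝ.trans p p′ , ℝ.trans q q′

    +ᶜ-cong : ∀ {u v w z} → u ≈ᶜ v → w ≈ᶜ z → u +ᶜ w ≈ᶜ v +ᶜ z
    +ᶜ-cong (p , q) (p′ , q′) = ℝ.+-cong p p′ , ℝ.+-cong q q′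

  opaque
    isCommutativeRing : IsCommutativeRing _≈ᶜ_ _+ᶜ_ _*ᶜ_ -ᶜ_ 0ᶜ 1ᶜ
    isCommutativeRing = record
      { isRing = record
        { +-isAbelianGroup = record
          { isGroup = record
            { isMonoid = record
              { isSemigroup = record
                { isMagma = record
                  { isEquivalence = record
                    { refl  = ℝ.refl , ℝ.refl
                    ; sym   = λ (p , q) → ℝ.sym p , ℝ.sym q
                    ; trans = ≈ᶜ-trans
                    }
                  ; ∙-cong = +ᶜ-cong
                  }
                ; assoc = λ _ _ _ → ℝ.+-assoc _ _ _ , ℝ.+-assoc _ _ _
                }
              ; identity = (λ _ → ℝ.+-identityˡ _ , ℝ.+-identityˡ _)
                         , (λ _ → ℝ.+-identityʳ _ , ℝ.+-identityʳ _)
              }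
            ; inverse = (λ _ → ℝ.-‿inverseˡ _ , ℝ.-‿inverseˡ _)
                      , (λ _ → ℝ.-‿inverseʳ _ , ℝ.-‿inverseʳ _)
            ; ⁻¹-cong = λ (p , q) → ℝ.-‿cong p , ℝ.-‿cong q
            }
          ; comm = λ _ _ → ℝ.+-comm _ _ , ℝ.+-comm _ _
          }
        ; *-cong = λ (p , q) (p′ , q′) →
            ℝ.+-cong (ℝ.*-cong p p′) (ℝ.-‿cong (ℝ.*-cong q q′)) ,
            ℝ.+-cong (ℝ.*-cong p q′) (ℝ.*-cong q p′)
        ; *-assoc = λ (a +i b) (c +i d) (x +i y) →
            *-assoc-re a b c d x y , *-assoc-im a b c d x y
        ; *-identity = *ᶜ-identityˡ , λ z → ≈ᶜ-trans (*ᶜ-comm z 1ᶜ) (*ᶜ-identityˡ z)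
        ; distrib = *ᶜ-distribˡ , λ z u v →
            ≈ᶜ-trans (*ᶜ-comm (u +ᶜ v) z)
              (≈ᶜ-trans (*ᶜ-distribˡ z u v) (+ᶜ-cong (*ᶜ-comm z u) (*ᶜ-comm z v)))
        }
      ; *-comm = *ᶜ-comm
      }

  private
    open AlgebraDefinitions _≈ᶜ_ using (Invertible)

    inverse-re : ∀ a b t → (a * a + b * b) * t ≈ 1# → a * (a * t) - b * (- (b * t)) ≈ 1#
    inverse-re a b t norm*t≈1 = begin
      a * (a * t) - b * (- (b * t))
        ≈⟨ ℝ.+-congˡ (ℝ.-‿cong (ℝ.-‿distribʳ-* b (b * t))) ⟨
      a * (a * t) + (- (- (b * (b * t))))
        ≈⟨ ℝ.+-congˡ (ℝ.-‿involutive (b * (b * t))) ⟩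
      a * (a * t) + b * (b * t)
        ≈⟨ ℝ.+-cong (ℝ.*-assoc a a t) (ℝ.*-assoc b b t) ⟨
      a * a * t + b * b * t
        ≈⟨ ℝ.distribʳ t (a * a) (b * b) ⟨
      (a * a + b * b) * t
        ≈⟨ norm*t≈1 ⟩
      1# ∎

    inverse-im : ∀ a b t → a * (- (b * t)) + b * (a * t) ≈ 0#
    inverse-im a b t = begin
      a * (- (b * t)) + b * (a * t)
        ≈⟨ ℝ.+-congʳ (ℝ.-‿distribʳ-* a (b * t)) ⟨
      - (a * (b * t)) + b * (a * t)
        ≈⟨ ℝ.+-congˡ (Pair.swap b a t) ⟩
      - (a * (b * t)) + a * (b * t)
        ≈⟨ ℝ.-‿inverseˡ (a * (b * t)) ⟩
      0# ∎

    norm#0 : ∀ z w → z #ᶜ w →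
      (re z - re w) * (re z - re w) + (im z - im w) * (im z - im w) # 0#
    norm#0 z w z#w = ℝ.xx+yy#0 (Sum.map (ℝ.x#y⇒x-y#0 {re z} {re w}) (ℝ.x#y⇒x-y#0 {im z} {im w}) z#w)

    inverseʳ⇒invertible : ∀ u v → u *ᶜ v ≈ᶜ 1ᶜ → Invertible 1ᶜ _*ᶜ_ u
    inverseʳ⇒invertible u v uv≈1 =
      v , ≈ᶜ-trans {v *ᶜ u} {u *ᶜ v} {1ᶜ} (*ᶜ-comm v u) uv≈1 , uv≈1

    #⇒invertible′ : ∀ a b → a * a + b * b # 0# → Invertible 1ᶜ _*ᶜ_ (a +i b)
    #⇒invertible′ a b n#0 = inverseʳ⇒invertible (a +i b) ((a * t) +i (- (b * t)))
      (inverse-re a b t (ℝ.inverseʳ (a * a + b * b) n#0) , inverse-im a b t)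
      where
      t : ℝ.Carrier
      t = ℝ.inverse (a * a + b * b) n#0

    opaque
      #⇒invertible : ∀ {z w} → z #ᶜ w → Invertible 1ᶜ _*ᶜ_ (z +ᶜ (-ᶜ w))
      #⇒invertible {z} {w} z#w = #⇒invertible′ (re z - re w) (im z - im w) (norm#0 z w z#w)

      invertible⇒# : ∀ {z w} → Invertible 1ᶜ _*ᶜ_ (z +ᶜ (-ᶜ w)) → z #ᶜ w
      invertible⇒# {z} {w} (v , (vu≈1 , _) , _) = Sum.map
        (λ xa#0 → ℝ.x-y#0⇒x#y {re z} {re w} (ℝ.xy#0⇒y#0 {re v} {a} xa#0))
        (λ 0#yb → ℝ.x-y#0⇒x#y {im z} {im w} (ℝ.xy#0⇒y#0 {im v} {b} (ℝ.#-sym 0#yb)))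
        (ℝ.#-cotrans xa#yb 0#)
        where
        a b : ℝ.Carrier
        a = re z - re w
        b = im z - im w
        xa#yb : re v * a # im v * b
        xa#yb = ℝ.x-y#0⇒x#y {re v * a} {im v * b}
          (ℝ.#-congʳ {1#} {re v * a - im v * b} {0#} (ℝ.sym vu≈1) ℝ.1#0)

    #-cotrans : ∀ {z w} → z #ᶜ w → ∀ u → z #ᶜ u ⊎ u #ᶜ w
    #-cotrans (inj₁ p) u = Sum.map inj₁ inj₁ (ℝ.#-cotrans p (re u))
    #-cotrans (inj₂ q) u = Sum.map inj₂ inj₂ (ℝ.#-cotrans q (im u))

  heytingField : HeytingField c ℓ₁ ℓ₂
  heytingField = record
    { Carrier = ℂ
    ; _≈_ = _≈ᶜ_
    ; _#_ = _#ᶜ_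
    ; _+_ = _+ᶜ_
    ; _*_ = _*ᶜ_
    ; -_  = -ᶜ_
    ; 0#  = 0ᶜ
    ; 1#  = 1ᶜ
    ; isHeytingField = record
      { isHeytingCommutativeRing = record
        { isCommutativeRing   = isCommutativeRing
        ; isApartnessRelation = record
          { irrefl  = λ { (p , q) → λ { (inj₁ r) → ℝ.#-irrefl p r
                                      ; (inj₂ r) → ℝ.#-irrefl q r } }
          ; sym     = Sum.map ℝ.#-sym ℝ.#-sym
          ; cotrans = #-cotrans
          }
        ; #⇒invertible = λ {z} {w} → #⇒invertible {z} {w}
        ; invertible⇒# = λ {z} {w} → invertible⇒# {z} {w}
        }
      ; tight = λ z w →
          (λ ¬z#w → proj₁ (ℝ.tight (re z) (re w)) (¬z#w ∘ inj₁) ,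
                    proj₁ (ℝ.tight (im z) (im w)) (¬z#w ∘ inj₂)) ,
          λ { (p , q) → λ { (inj₁ r) → ℝ.#-irrefl p r
                          ; (inj₂ r) → ℝ.#-irrefl q r } }
      }
    }

module ComplexAnalysis {c ℓ₁ ℓ₂ ℓ₃} (ℝ : RealField c ℓ₁ ℓ₂ ℓ₃) where

  private
    module ℝ = RealField ℝ

  open ComplexField ℝ public using (ℂ; _+i_; re; im; heytingField)
  open FieldOperations heytingField public

  ∣_∣² : ℂ → ℝ.Carrier
  ∣ z ∣² = re z ℝ.* re z ℝ.+ im z ℝ.* im z

  -- For r positive this is ∣ z ∣ < r, without the square root.
  infix 4 ∣_∣<_
  ∣_∣<_ : ℂ → ℝ.Carrier → Set ℓ₃
  ∣ z ∣< r = ∣ z ∣² ℝ.< r ℝ.* r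

  Function : ∀ {p} → (ℂ → Set p) → Set (c ⊔ p)
  Function D = ∀ z → D z → ℂ

  Limit : ∀ {p} (D : ℂ → Set p) → Function D → ℂ → ℂ → Set (c ⊔ ℓ₂ ⊔ ℓ₃ ⊔ p)
  Limit D f a l = ∀ ε → ℝ.0# ℝ.< ε → ∃ λ δ → ℝ.0# ℝ.< δ ×
    (∀ z (z∈D : D z) → z # a → ∣ z - a ∣< δ → ∣ f z z∈D - l ∣< ε)

  differenceQuotient : ∀ {p} (D : ℂ → Set p) → Function D →
                       ∀ z → D z → Function (λ w → D w × w # z)
  differenceQuotient D f z z∈D w (w∈D , w#z) =
    (f w w∈D - f z z∈D) / (w - z) ⟨ x#y⇒x-y#0 {w} {z} w#z ⟩

  Derivative : ∀ {p} (D : ℂ → Set p) → Function D → Function D → Set (c ⊔ ℓ₂ ⊔ ℓ₃ ⊔ p)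
  Derivative D f f′ = ∀ z (z∈D : D z) →
    Limit (λ w → D w × w # z) (differenceQuotient D f z z∈D) z (f′ z z∈D)

  data NthDerivative {p} (D : ℂ → Set p) : ℕ → Function D → Function D →
                     Set (c ⊔ ℓ₁ ⊔ ℓ₂ ⊔ ℓ₃ ⊔ p) where
    base : ∀ {f g} → (∀ z z∈D → f z z∈D ≈ g z z∈D) → NthDerivative D 0 f g
    step : ∀ {n f f′ g} → Derivative D f f′ → NthDerivative D n f′ g →
           NthDerivative D (ℕ.suc n) f g

{-# OPTIONS --safe #-}

-- With u = k - β, t = 1 / u, c = β - γ and d = β - δ, the function is
-- u ^ (n - 1) * R(t) for R(t) = ((1 + c t) (1 + d t)) ^ n. By Bol's lemma its n-th
-- derivative by k is (- 1) ^ n * t ^ (n + 1) * R⁽ⁿ⁾(t), with the derivative of R by t.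
-- The hypothesis says that the cross-ratio of α, β and γ, δ is harmonic, so that
-- τ = 1 / (α - β) is the midpoint of the roots of R and R(t) = (κ + q h²) ^ n
-- for h = t - τ: the n-th derivative at h = 0 is then immediate.
module Submission where

open import Defs
open import Level using (_⊔_)
open import Algebra.Apartness.Bundles using (HeytingField)
open import Algebra.Bundles using (CommutativeRing)
import Algebra.Properties.CommutativeSemiring.Exp as CommutativeSemiringExp
import Algebra.Properties.Ring as RingProperties
import Algebra.Properties.Semiring.Mult as SemiringMult
import Algebra.Properties.Semiring.Mult.TCOptimised as TCMult
import Algebra.Solver.Ring as RingSolver
open import Algebra.Solver.Ring.AlmostCommutativeRing
  using (fromCommutativeRing; _-Raw-AlmostCommutative⟶_)
open import Data.Empty using (⊥-elim)
open import Data.Integer.Base as ℤ using (ℤ)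
import Data.Integer.Properties as ℤ
open import Data.List.Base using (map; applyUpTo; [_]; _++_)
open import Data.List.Properties using (applyUpTo-∷ʳ; map-++)
open import Data.Maybe.Base using (Maybe; just; nothing)
open import Data.Nat.Base as ℕ using (ℕ; zero; suc; _!)
import Data.Nat.Properties as ℕ
open import Data.Nat.DivMod using (m*n/n≡m)
open import Data.Nat.Divisibility using (_∣_; _∤_; divides; ∣m∣n⇒∣m+n; ∣-refl)
open import Data.Nat.ListAction using (product)
open import Data.Nat.ListAction.Properties using (product-++)
open import Data.Nat.Tactic.RingSolver using (solve-∀)
open import Data.Product.Base using (∃; _×_; _,_; proj₁; proj₂)
open import Data.Sum.Base using (inj₁; inj₂)
open import Relation.Binary.Core using (Rel)
open import Relation.Binary.PropositionalEquality as ≡ using (_≡_)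
import Relation.Binary.Reasoning.Base.Triple as TripleReasoning
import Relation.Binary.Reasoning.Setoid as SetoidReasoning
open import Relation.Binary.Structures using (IsPreorder; IsStrictPartialOrder)
open import Relation.Nullary.Decidable.Core using (yes; no)
open import Relation.Nullary.Negation using (¬_)

-- `NthDerivative` speaks of ε-δ limits of partial functions over constructive reals, with neither
-- square roots nor decidable comparison. Analysis therefore enters the algebra only through a
-- relation `_↦_` closed under constants, sums and products (`IsDerivation`), and through the
-- derivatives of `u` and `t`. It is a relation and not an operator because not every function is
-- differentiable. No general chain rule is formed: composites with `t` are differentiated through
-- the product rule, by induction. The limit is then a value: the closed form of the n-th derivative
-- is differentiable again, hence continuous, and α lies in its domain. Origin of the constants: for
-- n = 2m, the n-th derivative of (κ + q h²)^n at h = 0 is (2m)! binomial(2m, m) (q κ)^m, that is,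
-- (4 q κ)^m times the square of (2m - 1)!!. Moreover 4 q κ is minus the discriminant of (1 + c t)
-- (1 + d t), namely -(γ - δ)², which yields both the sign and the power of γ - δ.

-- Unlike the library's solvers for abstract rings, this one decides the
-- vanishing of coefficients, so that it cancels x - x.
module IntegerCoefficients {c ℓ} (R : CommutativeRing c ℓ) where

  open CommutativeRing R
  open RingProperties ring
  open TCMult semiring using (×-homo-+; ×1-homo-*; ×-cong; 1+×) renaming (_×_ to _·_)
  open SetoidReasoning setoid

  private
    ⟦_⟧ : ℤ → Carrier
    ⟦ ℤ.+ n ⟧      = n · 1#
    ⟦ ℤ.-[1+ n ] ⟧ = - (suc n · 1#)

    ⟦⟧-cong : ∀ {i j} → i ≡ j → ⟦ i ⟧ ≈ ⟦ j ⟧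
    ⟦⟧-cong ≡.refl = refl

    cancel : ∀ x y z → (x + y) - (x + z) ≈ y - z
    cancel x y z = begin
      (x + y) - (x + z)          ≈⟨ +-cong (+-comm x y) (sym (-‿+-comm x z)) ⟩
      (y + x) + (- x + - z)      ≈⟨ +-assoc y x _ ⟩
      y + (x + (- x + - z))      ≈⟨ +-congˡ (+-assoc x _ _) ⟨
      y + ((x + - x) + - z)      ≈⟨ +-congˡ (trans (+-congʳ (-‿inverseʳ x)) (+-identityˡ _)) ⟩
      y - z                      ∎

    ⟦⟧-⊖ : ∀ m n → ⟦ m ℤ.⊖ n ⟧ ≈ m · 1# - n · 1#
    ⟦⟧-⊖ m       zero    = sym (trans (+-congˡ -0#≈0#) (+-identityʳ _))
    ⟦⟧-⊖ zero    (suc n) = sym (+-identityˡ _)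
    ⟦⟧-⊖ (suc m) (suc n) = begin
      ⟦ suc m ℤ.⊖ suc n ⟧                  ≈⟨ ⟦⟧-cong (ℤ.[1+m]⊖[1+n]≡m⊖n m n) ⟩
      ⟦ m ℤ.⊖ n ⟧                          ≈⟨ ⟦⟧-⊖ m n ⟩
      m · 1# - n · 1#                      ≈⟨ cancel 1# _ _ ⟨
      (1# + m · 1#) - (1# + n · 1#)        ≈⟨ +-cong (1+× m 1#) (-‿cong (1+× n 1#)) ⟨
      suc m · 1# - suc n · 1#              ∎

    +-homo : ∀ i j → ⟦ i ℤ.+ j ⟧ ≈ ⟦ i ⟧ + ⟦ j ⟧
    +-homo (ℤ.+ m)      (ℤ.+ n)      = ×-homo-+ 1# m n
    +-homo (ℤ.+ m)      ℤ.-[1+ n ]   = ⟦⟧-⊖ m (suc n)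
    +-homo ℤ.-[1+ m ]   (ℤ.+ n)      = trans (⟦⟧-⊖ n (suc m)) (+-comm _ _)
    +-homo ℤ.-[1+ m ]   ℤ.-[1+ n ]   = begin
      - (suc (suc (m ℕ.+ n)) · 1#)       ≈⟨ -‿cong (×-cong (≡.cong suc (ℕ.+-suc m n)) refl) ⟨
      - ((suc m ℕ.+ suc n) · 1#)         ≈⟨ -‿cong (×-homo-+ 1# (suc m) (suc n)) ⟩
      - (suc m · 1# + suc n · 1#)        ≈⟨ -‿+-comm _ _ ⟨
      - (suc m · 1#) - suc n · 1#        ∎

    -‿homo : ∀ i → ⟦ ℤ.- i ⟧ ≈ - ⟦ i ⟧
    -‿homo (ℤ.+ zero)  = sym -0#≈0#
    -‿homo (ℤ.+ suc n) = refl
    -‿homo ℤ.-[1+ n ]  = sym (-‿involutive _)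

    *-homo⁺⁺ : ∀ m n → ⟦ ℤ.+ m ℤ.* ℤ.+ n ⟧ ≈ m · 1# * n · 1#
    *-homo⁺⁺ m n = trans (⟦⟧-cong (≡.sym (ℤ.pos-* m n))) (×1-homo-* m n)

    *-homo⁺ : ∀ m j → ⟦ ℤ.+ m ℤ.* j ⟧ ≈ m · 1# * ⟦ j ⟧
    *-homo⁺ m (ℤ.+ n)    = *-homo⁺⁺ m n
    *-homo⁺ m ℤ.-[1+ n ] = begin
      ⟦ ℤ.+ m ℤ.* ℤ.-[1+ n ] ⟧         ≈⟨ ⟦⟧-cong (ℤ.neg-distribʳ-* (ℤ.+ m) (ℤ.+ suc n)) ⟨
      ⟦ ℤ.- (ℤ.+ m ℤ.* ℤ.+ suc n) ⟧    ≈⟨ -‿homo (ℤ.+ m ℤ.* ℤ.+ suc n) ⟩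
      - ⟦ ℤ.+ m ℤ.* ℤ.+ suc n ⟧        ≈⟨ -‿cong (*-homo⁺⁺ m (suc n)) ⟩
      - (m · 1# * suc n · 1#)          ≈⟨ -‿distribʳ-* _ _ ⟩
      m · 1# * - (suc n · 1#)          ∎

    *-homo : ∀ i j → ⟦ i ℤ.* j ⟧ ≈ ⟦ i ⟧ * ⟦ j ⟧
    *-homo (ℤ.+ m)    j = *-homo⁺ m j
    *-homo ℤ.-[1+ m ] j = begin
      ⟦ ℤ.-[1+ m ] ℤ.* j ⟧             ≈⟨ ⟦⟧-cong (ℤ.neg-distribˡ-* (ℤ.+ suc m) j) ⟨
      ⟦ ℤ.- (ℤ.+ suc m ℤ.* j) ⟧        ≈⟨ -‿homo (ℤ.+ suc m ℤ.* j) ⟩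
      - ⟦ ℤ.+ suc m ℤ.* j ⟧            ≈⟨ -‿cong (*-homo⁺ (suc m) j) ⟩
      - (suc m · 1# * ⟦ j ⟧)           ≈⟨ -‿distribˡ-* _ _ ⟩
      - (suc m · 1#) * ⟦ j ⟧           ∎

    homomorphism : CommutativeRing.rawRing ℤ.+-*-commutativeRing
                     -Raw-AlmostCommutative⟶ fromCommutativeRing R
    homomorphism = record
      { ⟦_⟧    = ⟦_⟧
      ; +-homo = +-homo
      ; *-homo = *-homo
      ; -‿homo = -‿homo
      ; 0-homo = refl
      ; 1-homo = refl
      }

    decide : ∀ i j → Maybe (⟦ i ⟧ ≈ ⟦ j ⟧)
    decide i j with i ℤ.≟ j
    ... | yes i≡j = just (⟦⟧-cong i≡j)
    ... | no  _   = nothing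

  open RingSolver _ (fromCommutativeRing R) homomorphism decide public

  :0 :1 : ∀ {n} → Polynomial n
  :0 = con (ℤ.+ 0)
  :1 = con (ℤ.+ 1)

-- Abstract derivations and Bol's lemma

record IsDerivation {c ℓ x d} (R : CommutativeRing c ℓ) {X : Set x}
                    (_↦_ : Rel (X → CommutativeRing.Carrier R) d) : Set (c ⊔ ℓ ⊔ x ⊔ d) where
  open CommutativeRing R
  field
    ↦-resp  : ∀ {f f₁ g g₁} → (∀ x → f x ≈ f₁ x) → (∀ x → g x ≈ g₁ x) → f ↦ g → f₁ ↦ g₁
    ↦-const : ∀ a → (λ _ → a) ↦ (λ _ → 0#)
    ↦-+     : ∀ {f f′ g g′} → f ↦ f′ → g ↦ g′ → (λ x → f x + g x) ↦ (λ x → f′ x + g′ x)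
    ↦-*     : ∀ {f f′ g g′} → f ↦ f′ → g ↦ g′ →
              (λ x → f x * g x) ↦ (λ x → f′ x * g x + f x * g′ x)

module Iteration {c ℓ x d} (R : CommutativeRing c ℓ) {X : Set x}
                 {_↦_ : Rel (X → CommutativeRing.Carrier R) d}
                 (isDerivation : IsDerivation R _↦_) where

  open CommutativeRing R
  open IsDerivation isDerivation
  open IntegerCoefficients R using (solve; _:+_; _:*_; :-_; _:=_; :0; :1)
  open CommutativeSemiringExp commutativeSemiring using (_^_)

  private
    fromℕ : ℕ → Carrier
    fromℕ n = SemiringMult._×_ semiring n 1#

  -- Has the same shape as `NthDerivative`, with `_↦_` in place of the limit, so that the passage to
  -- analysis is a plain recursion.
  data Iterated : ℕ → Rel (X → Carrier) (c ⊔ ℓ ⊔ x ⊔ d) where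
    base : ∀ {f g} → (∀ x → f x ≈ g x) → Iterated 0 f g
    step : ∀ {n f f′ g} → f ↦ f′ → Iterated n f′ g → Iterated (suc n) f g

  ↦-scale : ∀ a {f f′} → f ↦ f′ → (λ x → a * f x) ↦ (λ x → a * f′ x)
  ↦-scale a f↦ = ↦-resp (λ _ → refl)
    (λ _ → trans (+-congʳ (zeroˡ _)) (+-identityˡ _)) (↦-* (↦-const a) f↦)

  iterated-resp : ∀ {n f f₁ g g₁} → (∀ x → f x ≈ f₁ x) → (∀ x → g x ≈ g₁ x) →
                  Iterated n f g → Iterated n f₁ g₁
  iterated-resp f≈ g≈ (base f≈g)   = base (λ x → trans (sym (f≈ x)) (trans (f≈g x) (g≈ x)))
  iterated-resp f≈ g≈ (step f↦ it) =
    step (↦-resp f≈ (λ _ → refl) f↦) (iterated-resp (λ _ → refl) g≈ it)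

  iterated-+ : ∀ {n f₁ f₂ g₁ g₂} → Iterated n f₁ g₁ → Iterated n f₂ g₂ →
               Iterated n (λ x → f₁ x + f₂ x) (λ x → g₁ x + g₂ x)
  iterated-+ (base eq₁)    (base eq₂)    = base (λ x → +-cong (eq₁ x) (eq₂ x))
  iterated-+ (step f₁↦ i₁) (step f₂↦ i₂) = step (↦-+ f₁↦ f₂↦) (iterated-+ i₁ i₂)

  iterated-scale : ∀ a {n f g} → Iterated n f g → Iterated n (λ x → a * f x) (λ x → a * g x)
  iterated-scale a (base eq)   = base (λ x → *-congˡ (eq x))
  iterated-scale a (step f↦ i) = step (↦-scale a f↦) (iterated-scale a i)

  iterated-snoc : ∀ {n f g h} → Iterated n f g → g ↦ h → Iterated (suc n) f h
  iterated-snoc (base f≈g)  g↦ = step (↦-resp (λ x → sym (f≈g x)) (λ _ → refl) g↦) (base (λ _ → refl))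
  iterated-snoc (step f↦ i) g↦ = step f↦ (iterated-snoc i g↦)

  module Reciprocal (u t : X → Carrier) (ut≈1 : ∀ x → u x * t x ≈ 1#)
                    (u↦ : u ↦ λ _ → 1#) (t↦ : t ↦ λ x → - (t x * t x)) where

    -- The offset by one admits the exponent -1, where the two-step induction of `bol` starts.
    u^[_-1] : ℕ → X → Carrier
    u^[ zero  -1] = t
    u^[ suc n -1] x = u x ^ n

    u*u^[n-1] : ∀ n x → u x * u^[ n -1] x ≈ u^[ suc n -1] x
    u*u^[n-1] zero    x = ut≈1 x
    u*u^[n-1] (suc n) x = refl

    u^n*t : ∀ n x → u^[ suc n -1] x * t x ≈ u^[ n -1] x
    u^n*t zero    x = *-identityˡ _
    u^n*t (suc n) x = trans (solve 3 (λ u t p → u :* p :* t := u :* t :* p) refl (u x) (t x) (u x ^ n))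
      (trans (*-congʳ (ut≈1 x)) (*-identityˡ _))

    u^n↦ : ∀ n → u^[ suc n -1] ↦ λ x → fromℕ n * u^[ n -1] x
    u^n↦ zero    = ↦-resp (λ _ → refl) (λ _ → sym (zeroˡ _)) (↦-const 1#)
    u^n↦ (suc n) = ↦-resp (λ _ → refl)
      (λ x → trans
        (solve 4 (λ u p v n → :1 :* p :+ u :* (n :* v) := p :+ n :* (u :* v)) refl
          (u x) (u x ^ n) (u^[ n -1] x) (fromℕ n))
        (trans (+-congˡ (*-congˡ (u*u^[n-1] n x)))
          (solve 2 (λ p n → p :+ n :* p := (:1 :+ n) :* p) refl (u x ^ n) (fromℕ n))))
      (↦-* u↦ (u^n↦ n))

    t^n↦ : ∀ n → (λ x → t x ^ n) ↦ λ x → - (fromℕ n * t x ^ suc n)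
    t^n↦ zero    = ↦-resp (λ _ → refl)
      (λ x → solve 1 (λ t → :0 := :- (:0 :* (t :* :1))) refl (t x)) (↦-const 1#)
    t^n↦ (suc n) = ↦-resp (λ _ → refl)
      (λ x → solve 3 (λ t p n → :- (t :* t) :* p :+ t :* (:- (n :* (t :* p)))
                               := :- ((:1 :+ n) :* (t :* (t :* p)))) refl
                     (t x) (t x ^ n) (fromℕ n))
      (↦-* t↦ (t^n↦ n))

    -- Bol's lemma for the Möbius map t = 1 / u, whose derivative is - t²: for
    -- r k the k-th derivative of a function of t, the n-th derivative of
    -- u ^ (n - 1) * r 0 by u involves r n only.
    bol : ∀ n (r : ℕ → X → Carrier) → (∀ k → r k ↦ λ x → - (t x * t x) * r (suc k) x) →
          Iterated n (λ x → u^[ n -1] x * r 0 x) (λ x → (- 1#) ^ n * (t x ^ suc n * r n x))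
    bol zero r r↦ = base (λ x →
      solve 2 (λ t r → t :* r := :1 :* (t :* :1 :* r)) refl (t x) (r 0 x))
    bol (suc zero) r r↦ = step (↦-* (u^n↦ 0) (r↦ 0)) (base (λ x →
      solve 3 (λ t r r′ → :0 :* t :* r :+ :1 :* (:- (t :* t) :* r′)
                       := (:- :1) :* :1 :* (t :* (t :* :1) :* r′)) refl (t x) (r 0 x) (r 1 x)))
    -- Since `u ^ (n + 1) * t²` is `u ^ (n - 1)`, the first derivative is `(n + 1) * u ^ n * r 0 - u
    -- ^ (n - 1) * r 1`. Both terms have Bol's shape again, for `n + 1` and, with `r` shifted, for
    -- `n`. The second recursive call is one derivative short, which `iterated-snoc` supplies; in
    -- the sum the terms in `r (suc n)` cancel.
    bol (suc (suc n)) r r↦ =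
      step (↦-* (u^n↦ (suc n)) (r↦ 0)) (iterated-resp start end (iterated-+
        (iterated-scale (fromℕ (suc n)) (bol (suc n) r r↦))
        (iterated-scale (- 1#) (iterated-snoc (bol n (λ k → r (suc k)) (λ k → r↦ (suc k)))
          (↦-scale ((- 1#) ^ n) (↦-* (t^n↦ (suc n)) (r↦ (suc n))))))))
      where
      start : ∀ x → fromℕ (suc n) * (u^[ suc n -1] x * r 0 x) + - 1# * (u^[ n -1] x * r 1 x) ≈
                    fromℕ (suc n) * u^[ suc n -1] x * r 0 x
                      + u^[ suc (suc n) -1] x * (- (t x * t x) * r 1 x)
      start x = trans
        (+-congˡ (*-congˡ (*-congʳ (sym (trans (*-congʳ (u^n*t (suc n) x)) (u^n*t n x))))))
        (solve 6 (λ n p p′ t r r′ → n :* (p :* r) :+ :- :1 :* (p′ :* t :* t :* r′)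
                                 := n :* p :* r :+ p′ :* (:- (t :* t) :* r′)) refl
          (fromℕ (suc n)) (u^[ suc n -1] x) (u^[ suc (suc n) -1] x) (t x) (r 0 x) (r 1 x))
      end : ∀ x →
        fromℕ (suc n) * ((- 1#) ^ suc n * (t x ^ suc (suc n) * r (suc n) x))
          + - 1# * ((- 1#) ^ n * (- (fromℕ (suc n) * t x ^ suc (suc n)) * r (suc n) x
                                  + t x ^ suc n * (- (t x * t x) * r (suc (suc n)) x))) ≈
        (- 1#) ^ suc (suc n) * (t x ^ suc (suc (suc n)) * r (suc (suc n)) x)
      end x = solve 6 (λ n s p t r r′ →
        n :* (:- :1 :* s :* (t :* p :* r))
          :+ :- :1 :* (s :* (:- (n :* (t :* p)) :* r :+ p :* (:- (t :* t) :* r′)))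
        := :- :1 :* (:- :1 :* s) :* (t :* (t :* p) :* r′)) refl
        (fromℕ (suc n)) ((- 1#) ^ n) (t x ^ suc n) (t x) (r (suc n) x) (r (suc (suc n)) x)

-- Factorials and products of odd numbers

oddSquares : ℕ → ℕ
oddSquares m = product (map (λ i → (2 ℕ.* i ℕ.∸ 1) ℕ.^ 2) (applyUpTo suc m))

-- The double factorial (2m - 1)!!.
oddProduct : ℕ → ℕ
oddProduct zero    = 1
oddProduct (suc m) = suc (2 ℕ.* m) ℕ.* oddProduct m

oddSquares≡ : ∀ m → oddSquares m ≡ oddProduct m ℕ.* oddProduct m
oddSquares≡ zero    = ≡.refl
oddSquares≡ (suc m) = begin
  oddSquares (suc m)
    ≡⟨ ≡.cong (λ is → product (map sq is)) (applyUpTo-∷ʳ suc m) ⟨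
  product (map sq (applyUpTo suc m ++ [ suc m ]))
    ≡⟨ ≡.cong product (map-++ sq (applyUpTo suc m) [ suc m ]) ⟩
  product (map sq (applyUpTo suc m) ++ [ sq (suc m) ])
    ≡⟨ product-++ (map sq (applyUpTo suc m)) [ sq (suc m) ] ⟩
  oddSquares m ℕ.* (sq (suc m) ℕ.* 1)
    -- `2 ℕ.* suc m ℕ.∸ 1` computes to `m ℕ.+ suc (m ℕ.+ 0)`, so `ℕ.+-suc` alone removes the
    -- truncated subtraction.
    ≡⟨ ≡.cong₂ (λ a b → a ℕ.* (b ℕ.^ 2 ℕ.* 1)) (oddSquares≡ m) (ℕ.+-suc m (m ℕ.+ 0)) ⟩
  oddProduct m ℕ.* oddProduct m ℕ.* (suc (2 ℕ.* m) ℕ.^ 2 ℕ.* 1)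
    ≡⟨ rearrange (oddProduct m) (suc (2 ℕ.* m)) ⟩
  oddProduct (suc m) ℕ.* oddProduct (suc m) ∎
  where
  open ≡.≡-Reasoning
  sq : ℕ → ℕ
  sq i = (2 ℕ.* i ℕ.∸ 1) ℕ.^ 2
  rearrange : ∀ a b → a ℕ.* a ℕ.* (b ℕ.* (b ℕ.* 1) ℕ.* 1) ≡ b ℕ.* a ℕ.* (b ℕ.* a)
  rearrange = solve-∀

-- The factor of q ^ m * κ ^ i in the (2 m)-th derivative of (κ + q h²) ^ (m + i) at h = 0.
evenCoefficient : ℕ → ℕ → ℕ
evenCoefficient zero    i = 1
evenCoefficient (suc m) i =
  (suc (m ℕ.+ i) ℕ.+ suc (m ℕ.+ i)) ℕ.* suc (2 ℕ.* m) ℕ.* evenCoefficient m i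

-- By the binomial theorem the coefficient must be (2m)! binomial(m + i, m), which is 2^m (2m - 1)!!
-- (m + i)! / i!. The factor `i !` clears the division.
evenCoefficient-! : ∀ m i →
  evenCoefficient m i ℕ.* i ! ≡ 2 ℕ.^ m ℕ.* (m ℕ.+ i) ! ℕ.* oddProduct m
evenCoefficient-! zero    i = ≡.sym (ℕ.*-identityʳ _)
evenCoefficient-! (suc m) i = begin
  (a ℕ.+ a) ℕ.* b ℕ.* evenCoefficient m i ℕ.* i !
    ≡⟨ ℕ.*-assoc ((a ℕ.+ a) ℕ.* b) (evenCoefficient m i) (i !) ⟩
  (a ℕ.+ a) ℕ.* b ℕ.* (evenCoefficient m i ℕ.* i !)
    ≡⟨ ≡.cong ((a ℕ.+ a) ℕ.* b ℕ.*_) (evenCoefficient-! m i) ⟩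
  (a ℕ.+ a) ℕ.* b ℕ.* (2 ℕ.^ m ℕ.* (m ℕ.+ i) ! ℕ.* oddProduct m)
    ≡⟨ rearrange a b (2 ℕ.^ m) ((m ℕ.+ i) !) (oddProduct m) ⟩
  2 ℕ.* 2 ℕ.^ m ℕ.* (a ℕ.* (m ℕ.+ i) !) ℕ.* (b ℕ.* oddProduct m) ∎
  where
  open ≡.≡-Reasoning
  a b : ℕ
  a = suc (m ℕ.+ i)
  b = suc (2 ℕ.* m)
  rearrange : ∀ a b p f o →
    (a ℕ.+ a) ℕ.* b ℕ.* (p ℕ.* f ℕ.* o) ≡ 2 ℕ.* p ℕ.* (a ℕ.* f) ℕ.* (b ℕ.* o)
  rearrange = solve-∀

-- The even factors contribute `2 ℕ.^ m ℕ.* m !`, the odd ones the double factorial.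
[m+m]! : ∀ m → (m ℕ.+ m) ! ≡ 2 ℕ.^ m ℕ.* m ! ℕ.* oddProduct m
[m+m]! zero    = ≡.refl
[m+m]! (suc m) = begin
  (suc m ℕ.+ suc m) !
    ≡⟨ ≡.cong (λ k → suc k !) (ℕ.+-suc m m) ⟩
  suc (suc (m ℕ.+ m)) ℕ.* (suc (m ℕ.+ m) ℕ.* (m ℕ.+ m) !)
    ≡⟨ ≡.cong (λ f → suc (suc (m ℕ.+ m)) ℕ.* (suc (m ℕ.+ m) ℕ.* f)) ([m+m]! m) ⟩
  suc (suc (m ℕ.+ m)) ℕ.* (suc (m ℕ.+ m) ℕ.* (2 ℕ.^ m ℕ.* m ! ℕ.* oddProduct m))
    ≡⟨ rearrange m (2 ℕ.^ m) (m !) (oddProduct m) ⟩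
  2 ℕ.* 2 ℕ.^ m ℕ.* (suc m ℕ.* m !) ℕ.* (suc (2 ℕ.* m) ℕ.* oddProduct m) ∎
  where
  open ≡.≡-Reasoning
  rearrange : ∀ m p f o →
    suc (suc (m ℕ.+ m)) ℕ.* (suc (m ℕ.+ m) ℕ.* (p ℕ.* f ℕ.* o)) ≡
    2 ℕ.* p ℕ.* (suc m ℕ.* f) ℕ.* (suc (2 ℕ.* m) ℕ.* o)
  rearrange = solve-∀

-- At `i = m` the quotient (2m)! / m! brings in a second `2 ℕ.^ m` and a second double factorial:
-- hence the 4 and the squares.
evenCoefficient-diagonal : ∀ m → evenCoefficient m m ≡ 4 ℕ.^ m ℕ.* oddSquares m
evenCoefficient-diagonal m = ℕ.*-cancelʳ-≡ _ _ (m !) {{ℕ._!≢0 m}} (begin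
  evenCoefficient m m ℕ.* m !
    ≡⟨ evenCoefficient-! m m ⟩
  2 ℕ.^ m ℕ.* (m ℕ.+ m) ! ℕ.* oddProduct m
    ≡⟨ ≡.cong (λ f → 2 ℕ.^ m ℕ.* f ℕ.* oddProduct m) ([m+m]! m) ⟩
  2 ℕ.^ m ℕ.* (2 ℕ.^ m ℕ.* m ! ℕ.* oddProduct m) ℕ.* oddProduct m
    ≡⟨ rearrange (2 ℕ.^ m) (m !) (oddProduct m) ⟩
  2 ℕ.^ m ℕ.* 2 ℕ.^ m ℕ.* (oddProduct m ℕ.* oddProduct m) ℕ.* m !
    ≡⟨ ≡.cong₂ (λ p o → p ℕ.* o ℕ.* m !) 4^m (oddSquares≡ m) ⟨
  4 ℕ.^ m ℕ.* oddSquares m ℕ.* m ! ∎)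
  where
  open ≡.≡-Reasoning
  4^m : 4 ℕ.^ m ≡ 2 ℕ.^ m ℕ.* 2 ℕ.^ m
  4^m = ≡.trans (ℕ.^-*-assoc 2 2 m)
    (≡.trans (≡.cong (λ k → 2 ℕ.^ (m ℕ.+ k)) (ℕ.+-identityʳ m)) (ℕ.^-distribˡ-+-* 2 m m))
  rearrange : ∀ p f o → p ℕ.* (p ℕ.* f ℕ.* o) ℕ.* o ≡ p ℕ.* p ℕ.* (o ℕ.* o) ℕ.* f
  rearrange = solve-∀

-- Derivatives of powers of a quadratic without linear term

module QuadraticPower {c ℓ} (R : CommutativeRing c ℓ) (κ q : CommutativeRing.Carrier R) where

  open CommutativeRing R hiding (zero)
  open IntegerCoefficients R using (solve; _:+_; _:*_; _:=_; :0; :1)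
  open CommutativeSemiringExp commutativeSemiring using (_^_; ^-congˡ; ^-distrib-*; ^-assocʳ)
  open SemiringMult semiring using (×1-homo-*; ×-congˡ; ×-homo-+) renaming (_×_ to _·_)
  open SetoidReasoning setoid

  private
    fromℕ : ℕ → Carrier
    fromℕ n = n · 1#

  -- derivative j k is the k-th derivative of (κ + q h²) ^ j by h. The recursion is
  -- the Leibniz rule for the k-th derivative of 2 (j + 1) q h (κ + q h²) ^ j;
  -- for k = 0 the truncated subtraction is harmless, fromℕ k being 0.
  derivative : ℕ → ℕ → Carrier → Carrier
  derivative j       zero    h = (κ + q * (h * h)) ^ j
  derivative zero    (suc k) h = 0#
  derivative (suc j) (suc k) h = (fromℕ (suc j) + fromℕ (suc j)) * q *
    (h * derivative j k h + fromℕ k * derivative j (k ℕ.∸ 1) h)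

  -- The logarithmic derivative of a power, free of division. The product rule for
  -- `(κ + q h²) * (κ + q h²) ^ j` leaves this left side, while the recursion of `derivative`
  -- expects a multiple of the power itself.
  base*derivative₁ : ∀ j h →
    (κ + q * (h * h)) * derivative j 1 h ≈ (fromℕ j + fromℕ j) * q * (h * derivative j 0 h)
  base*derivative₁ zero    h = solve 3 (λ κ q h →
    (κ :+ q :* (h :* h)) :* :0 := (:0 :+ :0) :* q :* (h :* :1)) refl κ q h
  base*derivative₁ (suc j) h = solve 6 (λ κ q h p n p′ →
    (κ :+ q :* (h :* h)) :* (n :* q :* (h :* p :+ :0 :* p′))
      := n :* q :* (h :* ((κ :+ q :* (h :* h)) :* p))) refl
    κ q h (derivative j 0 h) (fromℕ (suc j) + fromℕ (suc j)) (derivative j 0 h)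

  module _ {x d} {X : Set x} {_↦_ : Rel (X → Carrier) d} (isDerivation : IsDerivation R _↦_)
           {h h′ : X → Carrier} (h↦ : h ↦ h′) where

    open IsDerivation isDerivation
    open Iteration R isDerivation using (↦-scale)

    -- Induction on the exponent reduces the chain rule for this family to the product rule: each
    -- clause differentiates the defining formula.
    derivative↦ : ∀ j k → (λ x → derivative j k (h x)) ↦ λ x → h′ x * derivative j (suc k) (h x)
    derivative↦ zero    zero    = ↦-resp (λ _ → refl) (λ _ → sym (zeroʳ _)) (↦-const 1#)
    derivative↦ zero    (suc k) = ↦-resp (λ _ → refl) (λ _ → sym (zeroʳ _)) (↦-const 0#)
    derivative↦ (suc j) zero    = ↦-resp (λ _ → refl)
      (λ x → begin
        (0# + q * (h′ x * h x + h x * h′ x)) * derivative j 0 (h x)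
          + (κ + q * (h x * h x)) * (h′ x * derivative j 1 (h x))
          ≈⟨ solve 6 (λ b q h h′ p p′ →
               (:0 :+ q :* (h′ :* h :+ h :* h′)) :* p :+ b :* (h′ :* p′)
               := h′ :* ((:1 :+ :1) :* (q :* (h :* p)) :+ b :* p′)) refl
             (κ + q * (h x * h x)) q (h x) (h′ x) (derivative j 0 (h x)) (derivative j 1 (h x)) ⟩
        h′ x * ((1# + 1#) * (q * (h x * derivative j 0 (h x)))
          + (κ + q * (h x * h x)) * derivative j 1 (h x))
          ≈⟨ *-congˡ (+-congˡ (base*derivative₁ j (h x))) ⟩
        h′ x * ((1# + 1#) * (q * (h x * derivative j 0 (h x)))
          + (fromℕ j + fromℕ j) * q * (h x * derivative j 0 (h x)))
          ≈⟨ solve 5 (λ q h h′ p n →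
               h′ :* ((:1 :+ :1) :* (q :* (h :* p)) :+ (n :+ n) :* q :* (h :* p))
               := h′ :* (((:1 :+ n) :+ (:1 :+ n)) :* q :* (h :* p :+ :0 :* p))) refl
             q (h x) (h′ x) (derivative j 0 (h x)) (fromℕ j) ⟩
        h′ x * derivative (suc j) 1 (h x) ∎)
      (↦-* (↦-+ (↦-const κ) (↦-scale q (↦-* h↦ h↦))) (derivative↦ j zero))
    -- Separate from the general case because `0 ℕ.∸ 1` is 0: differentiating
    -- `derivative j (k ℕ.∸ 1)` does not lead to order `k` here, but its coefficient is zero.
    derivative↦ (suc j) (suc zero) = ↦-resp (λ _ → refl)
      (λ x → solve 6 (λ n h h′ p p′ p″ →
        n :* ((h′ :* p :+ h :* (h′ :* p′)) :+ :0 :* p″)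
        := h′ :* (n :* (h :* p′ :+ (:1 :+ :0) :* p))) refl
        ((fromℕ (suc j) + fromℕ (suc j)) * q) (h x) (h′ x)
        (derivative j 0 (h x)) (derivative j 1 (h x)) (h′ x * derivative j 1 (h x)))
      (↦-scale _ (↦-+ (↦-* h↦ (derivative↦ j 0)) (↦-scale 0# (derivative↦ j 0))))
    derivative↦ (suc j) (suc (suc k)) = ↦-resp (λ _ → refl)
      (λ x → solve 6 (λ n h h′ p p′ k →
        n :* ((h′ :* p :+ h :* (h′ :* p′)) :+ k :* (h′ :* p))
        := h′ :* (n :* (h :* p′ :+ (:1 :+ k) :* p))) refl
        ((fromℕ (suc j) + fromℕ (suc j)) * q) (h x) (h′ x)
        (derivative j (suc k) (h x)) (derivative j (suc (suc k)) (h x)) (fromℕ (suc k)))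
      (↦-scale _ (↦-+ (↦-* h↦ (derivative↦ j (suc k))) (↦-scale (fromℕ (suc k)) (derivative↦ j k))))

  module _ {h : Carrier} (h≈0 : h ≈ 0#) where

    -- The summand with the factor `h` drops out, so at `h = 0` the recursion lowers the order by
    -- two. Vanishing at odd orders and the closed form at even ones both rest on this.
    derivative-shift : ∀ j k → derivative (suc j) (suc (suc k)) h ≈
      (fromℕ (suc j) + fromℕ (suc j)) * fromℕ (suc k) * (q * derivative j k h)
    derivative-shift j k = trans (*-congˡ (+-congʳ (*-congʳ h≈0)))
      (solve 5 (λ n q k p p′ → n :* q :* (:0 :* p′ :+ k :* p) := n :* k :* (q :* p)) refl
        (fromℕ (suc j) + fromℕ (suc j)) q (fromℕ (suc k)) (derivative j k h) (derivative j (suc k) h))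

    derivative-odd : ∀ j k → 2 ∤ k → derivative j k h ≈ 0#
    derivative-odd j       zero          2∤k = ⊥-elim (2∤k (divides 0 ≡.refl))
    derivative-odd zero    (suc k)       2∤k = refl
    derivative-odd (suc j) (suc zero)    2∤k = trans (*-congˡ (+-congʳ (*-congʳ h≈0)))
      (solve 2 (λ n p → n :* (:0 :* p :+ :0 :* p) := :0) refl _ _)
    derivative-odd (suc j) (suc (suc k)) 2∤k = trans (derivative-shift j k)
      (trans (*-congˡ (trans (*-congˡ (derivative-odd j k (λ 2∣k → 2∤k (∣m∣n⇒∣m+n ∣-refl 2∣k))))
        (zeroʳ _))) (zeroʳ _))

    -- Each shift trades one of the `m ℕ.+ i` factors for a `q`; the `i` factors left at order zero
    -- contribute `κ` each.
    derivative-even : ∀ m i →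
      derivative (m ℕ.+ i) (2 ℕ.* m) h ≈ fromℕ (evenCoefficient m i) * (q ^ m * κ ^ i)
    derivative-even zero    i = begin
      (κ + q * (h * h)) ^ i     ≈⟨ ^-congˡ i (+-congˡ (*-congˡ (*-congˡ h≈0))) ⟩
      (κ + q * (h * 0#)) ^ i    ≈⟨ ^-congˡ i (solve 3 (λ κ q h → κ :+ q :* (h :* :0) := κ) refl κ q h) ⟩
      κ ^ i                     ≈⟨ solve 1 (λ p → p := (:1 :+ :0) :* (:1 :* p)) refl (κ ^ i) ⟩
      fromℕ 1 * (1# * κ ^ i)    ∎
    derivative-even (suc m) i = begin
      derivative (suc (m ℕ.+ i)) (2 ℕ.* suc m) h
        ≡⟨ ≡.cong (λ k → derivative (suc (m ℕ.+ i)) (suc k) h) (ℕ.+-suc m (m ℕ.+ 0)) ⟩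
      derivative (suc (m ℕ.+ i)) (suc (suc (2 ℕ.* m))) h
        ≈⟨ derivative-shift (m ℕ.+ i) (2 ℕ.* m) ⟩
      (fromℕ a + fromℕ a) * fromℕ b * (q * derivative (m ℕ.+ i) (2 ℕ.* m) h)
        ≈⟨ *-cong (trans (×1-homo-* (a ℕ.+ a) b) (*-congʳ (×-homo-+ 1# a a)))
                  (*-congˡ (sym (derivative-even m i))) ⟨
      fromℕ ((a ℕ.+ a) ℕ.* b) * (q * (fromℕ (evenCoefficient m i) * (q ^ m * κ ^ i)))
        ≈⟨ solve 5 (λ n q e p k → n :* (q :* (e :* (p :* k))) := n :* e :* (q :* p :* k)) refl
             _ _ _ _ _ ⟩
      fromℕ ((a ℕ.+ a) ℕ.* b) * fromℕ (evenCoefficient m i) * (q * q ^ m * κ ^ i)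
        ≈⟨ *-congʳ (×1-homo-* ((a ℕ.+ a) ℕ.* b) (evenCoefficient m i)) ⟨
      fromℕ (evenCoefficient (suc m) i) * (q ^ suc m * κ ^ i) ∎
      where
      a b : ℕ
      a = suc (m ℕ.+ i)
      b = suc (2 ℕ.* m)

    -- With order equal to exponent, `q` and `κ` occur equally often and merge with `4 ℕ.^ m` into a
    -- power of the discriminant term evaluated in `4qκ`.
    derivative-diagonal : ∀ m → derivative (2 ℕ.* m) (2 ℕ.* m) h ≈
      (fromℕ 4 * (q * κ)) ^ m * fromℕ (oddSquares m)
    derivative-diagonal m = begin
      derivative (2 ℕ.* m) (2 ℕ.* m) h
        ≡⟨ ≡.cong (λ j → derivative (m ℕ.+ j) (2 ℕ.* m) h) (ℕ.+-identityʳ m) ⟩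
      derivative (m ℕ.+ m) (2 ℕ.* m) h
        ≈⟨ derivative-even m m ⟩
      fromℕ (evenCoefficient m m) * (q ^ m * κ ^ m)
        ≈⟨ *-congʳ (×-congˡ (evenCoefficient-diagonal m)) ⟩
      fromℕ (4 ℕ.^ m ℕ.* oddSquares m) * (q ^ m * κ ^ m)
        ≈⟨ *-cong (trans (×1-homo-* (4 ℕ.^ m) (oddSquares m)) (*-congʳ (fromℕ-^ 4 m)))
                  (sym (^-distrib-* q κ m)) ⟩
      fromℕ 4 ^ m * fromℕ (oddSquares m) * (q * κ) ^ m
        ≈⟨ solve 3 (λ x y z → x :* y :* z := x :* z :* y) refl _ _ _ ⟩
      fromℕ 4 ^ m * (q * κ) ^ m * fromℕ (oddSquares m)
        ≈⟨ *-congʳ (^-distrib-* (fromℕ 4) (q * κ) m) ⟨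
      (fromℕ 4 * (q * κ)) ^ m * fromℕ (oddSquares m) ∎
      where
      fromℕ-^ : ∀ a m → fromℕ (a ℕ.^ m) ≈ fromℕ a ^ m
      fromℕ-^ a zero    = +-identityʳ 1#
      fromℕ-^ a (suc m) = trans (×1-homo-* a (a ℕ.^ m)) (*-congˡ (fromℕ-^ a m))

-- Constructive order on the reals

module OrderProperties {c ℓ₁ ℓ₂ ℓ₃} (ℝ : RealField c ℓ₁ ℓ₂ ℓ₃) where

  open RealField ℝ
  open RealProperties ℝ
  open IsStrictPartialOrder isStrictPartialOrder public
    using (<-respˡ-≈; <-respʳ-≈; <-resp-≈)
    renaming (irrefl to <-irrefl; trans to <-trans; asym to <-asym)
  open IntegerCoefficients commutativeRing using (solve; _:+_; _:*_; :-_; _:-_; _:=_; :0; :1)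
  open SemiringMult semiring using (×1-homo-*; ×-homo-+)

  infix 4 _≤_
  -- Constructively weaker than `x < y ⊎ x ≈ y`; `<-cotrans` still lets it compose with `<`.
  _≤_ : Rel Carrier ℓ₃
  x ≤ y = ¬ y < x

  <-≤-trans : ∀ {x y z} → x < y → y ≤ z → x < z
  <-≤-trans {z = z} x<y y≤z with <-cotrans x<y z
  ... | inj₁ x<z = x<z
  ... | inj₂ z<y = ⊥-elim (y≤z z<y)

  ≤-<-trans : ∀ {x y z} → x ≤ y → y < z → x < z
  ≤-<-trans {x} x≤y y<z with <-cotrans y<z x
  ... | inj₁ y<x = ⊥-elim (x≤y y<x)
  ... | inj₂ x<z = x<z

  <⇒≤ : ∀ {x y} → x < y → x ≤ y
  <⇒≤ x<y y<x = <-asym x<y y<x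

  ≤-isPreorder : IsPreorder _≈_ _≤_
  ≤-isPreorder = record
    { isEquivalence = isEquivalence
    ; reflexive = λ x≈y y<x → <-irrefl (sym x≈y) y<x
    ; trans = λ x≤y y≤z z<x → y≤z (<-≤-trans z<x x≤y)
    }

  module ≤-Reasoning = TripleReasoning ≤-isPreorder
    <-asym <-trans <-resp-≈ <⇒≤ <-≤-trans ≤-<-trans
  open ≤-Reasoning

  x<y⇒0<y-x : ∀ {x y} → x < y → 0# < y - x
  x<y⇒0<y-x {x} {y} x<y = begin-strict
    0#         ≈⟨ -‿inverseˡ x ⟨
    - x + x    <⟨ +-monoʳ-< (- x) x<y ⟩
    - x + y    ≈⟨ +-comm (- x) y ⟩
    y - x      ∎

  0<y-x⇒x<y : ∀ {x y} → 0# < y - x → x < y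
  0<y-x⇒x<y {x} {y} 0<y-x = begin-strict
    x            ≈⟨ +-identityʳ x ⟨
    x + 0#       <⟨ +-monoʳ-< x 0<y-x ⟩
    x + (y - x)  ≈⟨ solve 2 (λ x y → x :+ (y :- x) := y) refl x y ⟩
    y            ∎

  x≤y⇒0≤y-x : ∀ {x y} → x ≤ y → 0# ≤ y - x
  x≤y⇒0≤y-x {x} {y} x≤y y-x<0 = x≤y (0<y-x⇒x<y (<-respʳ-≈
    (solve 2 (λ x y → :0 :- (y :- x) := x :- y) refl x y) (x<y⇒0<y-x y-x<0)))

  0≤y-x⇒x≤y : ∀ {x y} → 0# ≤ y - x → x ≤ y
  0≤y-x⇒x≤y {x} {y} 0≤y-x y<x = 0≤y-x (0<y-x⇒x<y (<-respʳ-≈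
    (solve 2 (λ x y → x :- y := :0 :- (y :- x)) refl x y) (x<y⇒0<y-x y<x)))

  +-monoˡ-≤ : ∀ z {x y} → x ≤ y → x + z ≤ y + z
  +-monoˡ-≤ z {x} {y} x≤y y+z<x+z = x≤y (begin-strict
    y                ≈⟨ solve 2 (λ y z → y := :- z :+ (y :+ z)) refl y z ⟩
    - z + (y + z)    <⟨ +-monoʳ-< (- z) y+z<x+z ⟩
    - z + (x + z)    ≈⟨ solve 2 (λ y z → y := :- z :+ (y :+ z)) refl x z ⟨
    x                ∎)

  +-monoʳ-≤ : ∀ z {x y} → x ≤ y → z + x ≤ z + y
  +-monoʳ-≤ z {x} {y} x≤y = begin
    z + x  ≈⟨ +-comm z x ⟩
    x + z  ≤⟨ +-monoˡ-≤ z x≤y ⟩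
    y + z  ≈⟨ +-comm y z ⟩
    z + y  ∎

  +-mono-< : ∀ {x y z w} → x < y → z < w → x + z < y + w
  +-mono-< {x} {y} {z} {w} x<y z<w = begin-strict
    x + z  <⟨ +-monoʳ-< x z<w ⟩
    x + w  ≈⟨ +-comm x w ⟩
    w + x  <⟨ +-monoʳ-< w x<y ⟩
    w + y  ≈⟨ +-comm w y ⟩
    y + w  ∎

  +-nonnegative : ∀ {x y} → 0# ≤ x → 0# ≤ y → 0# ≤ x + y
  +-nonnegative {x} {y} 0≤x 0≤y = begin
    0#      ≤⟨ 0≤x ⟩
    x       ≈⟨ +-identityʳ x ⟨
    x + 0#  ≤⟨ +-monoʳ-≤ x 0≤y ⟩
    x + y   ∎

  -- The refuted assumption `x * y < 0#` makes both factors apart from zero, so their signs become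
  -- decidable.
  *-nonnegative : ∀ {x y} → 0# ≤ x → 0# ≤ y → 0# ≤ x * y
  *-nonnegative {x} {y} 0≤x 0≤y xy<0
    with #⇒<⊎> (xy#0⇒y#0 {x} {y} (<⇒# xy<0))
       | #⇒<⊎> (xy#0⇒y#0 {y} {x} (#-congʳ (*-comm x y) (<⇒# xy<0)))
  ... | inj₁ y<0 | _        = 0≤y y<0
  ... | _        | inj₁ x<0 = 0≤x x<0
  ... | inj₂ 0<y | inj₂ 0<x = <-asym xy<0 (*-positive 0<x 0<y)

  *-monoˡ-≤ : ∀ {z} → 0# ≤ z → ∀ {x y} → x ≤ y → z * x ≤ z * y
  *-monoˡ-≤ {z} 0≤z {x} {y} x≤y = 0≤y-x⇒x≤y (begin
    0#             ≤⟨ *-nonnegative 0≤z (x≤y⇒0≤y-x x≤y) ⟩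
    z * (y - x)    ≈⟨ solve 3 (λ z x y → z :* (y :- x) := z :* y :- z :* x) refl z x y ⟩
    z * y - z * x  ∎)

  *-mono-≤ : ∀ {x y z w} → 0# ≤ x → 0# ≤ w → x ≤ y → z ≤ w → x * z ≤ y * w
  *-mono-≤ {x} {y} {z} {w} 0≤x 0≤w x≤y z≤w = begin
    x * z  ≤⟨ *-monoˡ-≤ 0≤x z≤w ⟩
    x * w  ≈⟨ *-comm x w ⟩
    w * x  ≤⟨ *-monoˡ-≤ 0≤w x≤y ⟩
    w * y  ≈⟨ *-comm w y ⟩
    y * w  ∎

  *-monoˡ-< : ∀ {z} → 0# < z → ∀ {x y} → x < y → z * x < z * y
  *-monoˡ-< {z} 0<z {x} {y} x<y = 0<y-x⇒x<y (begin-strict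
    0#             <⟨ *-positive 0<z (x<y⇒0<y-x x<y) ⟩
    z * (y - x)    ≈⟨ solve 3 (λ z x y → z :* (y :- x) := z :* y :- z :* x) refl z x y ⟩
    z * y - z * x  ∎)

  -- The strict inequality makes `z * (y - x)`, hence `y - x`, apart from zero; a negative sign
  -- would contradict `*-monoˡ-≤`.
  *-cancelˡ-< : ∀ {z} → 0# ≤ z → ∀ {x y} → z * x < z * y → x < y
  *-cancelˡ-< {z} 0≤z {x} {y} zx<zy
    with #⇒<⊎> (xy#0⇒y#0 {z} {y - x} (#-sym (<⇒# (<-respʳ-≈
           (solve 3 (λ z x y → z :* y :- z :* x := z :* (y :- x)) refl z x y)
           (x<y⇒0<y-x zx<zy)))))
  ... | inj₂ 0<y-x = 0<y-x⇒x<y 0<y-x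
  ... | inj₁ y-x<0 = ⊥-elim (*-monoˡ-≤ 0≤z (<⇒≤ y<x) zx<zy)
    where
    y<x : y < x
    y<x = 0<y-x⇒x<y (<-respʳ-≈
      (solve 2 (λ x y → :0 :- (y :- x) := x :- y) refl x y) (x<y⇒0<y-x y-x<0))

  0≤xx : ∀ x → 0# ≤ x * x
  0≤xx x = xx≮0

  0<1 : 0# < 1#
  0<1 = <-respʳ-≈ (*-identityˡ 1#) (x#0⇒0<xx 1#0)

  0≤fromℕ : ∀ n → 0# ≤ fromℕ n
  0≤fromℕ zero    = <-irrefl refl
  0≤fromℕ (suc n) = +-nonnegative (<⇒≤ 0<1) (0≤fromℕ n)

  0<fromℕ[1+n] : ∀ n → 0# < fromℕ (suc n)
  0<fromℕ[1+n] n = begin-strict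
    0#                ≈⟨ +-identityˡ 0# ⟨
    0# + 0#           ≤⟨ +-monoʳ-≤ 0# (0≤fromℕ n) ⟩
    0# + fromℕ n      ≈⟨ +-comm _ _ ⟩
    fromℕ n + 0#      <⟨ +-monoʳ-< (fromℕ n) 0<1 ⟩
    fromℕ n + 1#      ≈⟨ +-comm _ _ ⟩
    fromℕ (suc n)     ∎

  x+x<1∧y+y<1⇒x+y<1 : ∀ {x y} → x + x < 1# → y + y < 1# → x + y < 1#
  x+x<1∧y+y<1⇒x+y<1 {x} {y} x+x<1 y+y<1 = *-cancelˡ-< (<⇒≤ (0<fromℕ[1+n] 1)) (begin-strict
    fromℕ 2 * (x + y)      ≈⟨ solve 2 (λ x y → (:1 :+ (:1 :+ :0)) :* (x :+ y) := x :+ x :+ (y :+ y)) refl x y ⟩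
    x + x + (y + y)        <⟨ +-mono-< x+x<1 y+y<1 ⟩
    1# + 1#                ≈⟨ solve 0 (:1 :+ :1 := (:1 :+ (:1 :+ :0)) :* :1) refl ⟩
    fromℕ 2 * 1#           ∎)

  fromℕ-homo-+ : ∀ m n → fromℕ (m ℕ.+ n) ≈ fromℕ m + fromℕ n
  fromℕ-homo-+ = ×-homo-+ 1#

  fromℕ-homo-* : ∀ m n → fromℕ (m ℕ.* n) ≈ fromℕ m * fromℕ n
  fromℕ-homo-* = ×1-homo-*

  x<1/[m+n]⇒x<1/m : ∀ m n {x} → 0# ≤ x → fromℕ (m ℕ.+ n) * x < 1# → fromℕ m * x < 1#
  x<1/[m+n]⇒x<1/m m n {x} 0≤x [m+n]x<1 = begin-strict
    fromℕ m * x                   ≈⟨ +-identityʳ _ ⟨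
    fromℕ m * x + 0#              ≤⟨ +-monoʳ-≤ _ (*-nonnegative (0≤fromℕ n) 0≤x) ⟩
    fromℕ m * x + fromℕ n * x     ≈⟨ distribʳ x _ _ ⟨
    (fromℕ m + fromℕ n) * x       ≈⟨ *-congʳ (fromℕ-homo-+ m n) ⟨
    fromℕ (m ℕ.+ n) * x           <⟨ [m+n]x<1 ⟩
    1#                            ∎

  x<1/[m+n]⇒x<1/n : ∀ m n {x} → 0# ≤ x → fromℕ (m ℕ.+ n) * x < 1# → fromℕ n * x < 1#
  x<1/[m+n]⇒x<1/n m n 0≤x [m+n]x<1 = x<1/[m+n]⇒x<1/m n m 0≤x (<-respˡ-≈
    (*-congʳ (trans (fromℕ-homo-+ m n) (trans (+-comm _ _) (sym (fromℕ-homo-+ n m))))) [m+n]x<1)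

  -- An Archimedean bound for 1 / ε² serves as `n`. With `δδ<1/n` this translates between ε-δ bounds
  -- on squared norms and bounds of the form `n * x < 1`.
  1/n<εε : ∀ ε → 0# < ε → ∃ λ n → ∀ {x} → fromℕ n * x < 1# → x < ε * ε
  1/n<εε ε 0<ε = n , λ {x} nx<1 → *-cancelˡ-< (0≤fromℕ n) (begin-strict
    fromℕ n * x          <⟨ nx<1 ⟩
    1#                   ≈⟨ inverseʳ (ε * ε) εε#0 ⟨
    ε * ε * inverse (ε * ε) εε#0  <⟨ *-monoˡ-< (*-positive 0<ε 0<ε) (proj₂ bound) ⟩
    ε * ε * fromℕ n      ≈⟨ *-comm _ _ ⟩
    fromℕ n * (ε * ε)    ∎)
    where
    εε#0 : ε * ε # 0#
    εε#0 = #-sym (<⇒# (*-positive 0<ε 0<ε))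
    bound : ∃ λ n → inverse (ε * ε) εε#0 < fromℕ n
    bound = archimedean (inverse (ε * ε) εε#0)
    n : ℕ
    n = proj₁ bound

  -- Taking 1 / (n + 1) for `δ` avoids a square root: n x ≤ (n + 1)² x < ((n + 1) δ)² = 1.
  δδ<1/n : ∀ n → ∃ λ δ → 0# < δ × (∀ {x} → 0# ≤ x → x < δ * δ → fromℕ n * x < 1#)
  δδ<1/n n = δ , 0<δ , λ {x} 0≤x x<δδ → begin-strict
    fromℕ n * x          ≈⟨ +-identityˡ _ ⟨
    0# + fromℕ n * x     ≤⟨ +-monoˡ-≤ _ 0≤x ⟩
    x + fromℕ n * x      ≈⟨ solve 2 (λ n x → x :+ n :* x := (:1 :+ n) :* x) refl (fromℕ n) x ⟩
    s * x                ≈⟨ *-identityˡ _ ⟨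
    1# * (s * x)         ≤⟨ *-mono-≤ (<⇒≤ 0<1) (*-nonnegative (<⇒≤ 0<s) 0≤x) 1≤s (<-irrefl refl) ⟩
    s * (s * x)          <⟨ *-monoˡ-< 0<s (*-monoˡ-< 0<s x<δδ) ⟩
    s * (s * (δ * δ))    ≈⟨ solve 2 (λ s δ → s :* (s :* (δ :* δ)) := s :* δ :* (s :* δ)) refl s δ ⟩
    s * δ * (s * δ)      ≈⟨ *-cong sδ≈1 sδ≈1 ⟩
    1# * 1#              ≈⟨ *-identityˡ 1# ⟩
    1#                   ∎
    where
    s δ : Carrier
    s = fromℕ (suc n)
    0<s : 0# < s
    0<s = 0<fromℕ[1+n] n
    s#0 : s # 0#
    s#0 = #-sym (<⇒# 0<s)
    δ = inverse s s#0
    sδ≈1 : s * δ ≈ 1#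
    sδ≈1 = inverseʳ s s#0
    0<δ : 0# < δ
    0<δ = *-cancelˡ-< (<⇒≤ 0<s) (begin-strict
      s * 0#  ≈⟨ zeroʳ s ⟩
      0#      <⟨ 0<1 ⟩
      1#      ≈⟨ sδ≈1 ⟨
      s * δ   ∎)
    1≤s : 1# ≤ s
    1≤s = begin
      1#            ≈⟨ +-identityʳ 1# ⟨
      1# + 0#       ≤⟨ +-monoʳ-≤ 1# (0≤fromℕ n) ⟩
      s             ∎

-- Squared norms, continuity and Carathéodory derivatives

record IsSquaredNorm {c ℓ₁ ℓ₂ ℓ₃ c′ ℓ′} (ℝ : RealField c ℓ₁ ℓ₂ ℓ₃) (R : CommutativeRing c′ ℓ′)
                     (∥_∥ : CommutativeRing.Carrier R → RealField.Carrier ℝ) :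
                     Set (c ⊔ ℓ₁ ⊔ ℓ₃ ⊔ c′ ⊔ ℓ′) where
  private
    module ℝ = RealField ℝ
  open OrderProperties ℝ using (_≤_)
  open CommutativeRing R
  field
    ∥∥-cong        : ∀ {x y} → x ≈ y → ∥ x ∥ ℝ.≈ ∥ y ∥
    ∥∥-nonnegative : ∀ x → ℝ.0# ≤ ∥ x ∥
    ∥0∥≈0          : ∥ 0# ∥ ℝ.≈ ℝ.0#
    ∥1∥≈1          : ∥ 1# ∥ ℝ.≈ ℝ.1#
    ∥-∥            : ∀ x → ∥ - x ∥ ℝ.≈ ∥ x ∥
    ∥∥-homo-*      : ∀ x y → ∥ x * y ∥ ℝ.≈ ∥ x ∥ ℝ.* ∥ y ∥
    ∥∥-+           : ∀ x y → ∥ x + y ∥ ≤ (∥ x ∥ ℝ.+ ∥ x ∥) ℝ.+ (∥ y ∥ ℝ.+ ∥ y ∥)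

module Continuity {c ℓ₁ ℓ₂ ℓ₃ c′ ℓ′ x} (ℝ : RealField c ℓ₁ ℓ₂ ℓ₃) (R : CommutativeRing c′ ℓ′)
                  {∥_∥ : CommutativeRing.Carrier R → RealField.Carrier ℝ}
                  (isSquaredNorm : IsSquaredNorm ℝ R ∥_∥)
                  {X : Set x} (ι : X → CommutativeRing.Carrier R) where

  private
    module ℝ where
      open RealField ℝ public
      open OrderProperties ℝ public
    open ℝ using (fromℕ; _≤_; _<_)
  open CommutativeRing R
  open IsSquaredNorm isSquaredNorm
  open IntegerCoefficients ℝ.commutativeRing using () renaming
    (solve to solveℝ; _:+_ to _⊕_; _:*_ to _⊗_; :-_ to ⊝_; _:=_ to _⊜_; :0 to 𝟘; :1 to 𝟙)
  open IntegerCoefficients R using (solve; _:+_; _:*_; :-_; _:-_; _:=_; :1)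

  -- Measuring smallness by n * ∥ z ∥ < 1 with natural n avoids square roots, and
  -- two neighbourhoods are intersected by adding their n, without a minimum.
  Vanishing : X → (X → Carrier) → Set (ℓ₃ ⊔ x)
  Vanishing a φ = ∀ m → ∃ λ n → ∀ z →
    fromℕ n ℝ.* ∥ ι z - ι a ∥ < ℝ.1# → fromℕ m ℝ.* ∥ φ z ∥ < ℝ.1#

  vanishing-resp : ∀ {a φ ψ} → (∀ z → φ z ≈ ψ z) → Vanishing a φ → Vanishing a ψ
  vanishing-resp φ≈ψ vφ m = let n , bound = vφ m in
    n , λ z near → ℝ.<-respˡ-≈ (ℝ.*-congˡ (∥∥-cong (φ≈ψ z))) (bound z near)

  vanishing-+ : ∀ {a φ ψ} → Vanishing a φ → Vanishing a ψ → Vanishing a (λ z → φ z + ψ z)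
  vanishing-+ {a} {φ} {ψ} vφ vψ m = nφ ℕ.+ nψ , λ z near →
    let p = ∥ φ z ∥ ; q = ∥ ψ z ∥ in begin-strict
    fromℕ m ℝ.* ∥ φ z + ψ z ∥
      ≤⟨ ℝ.*-monoˡ-≤ (ℝ.0≤fromℕ m) (∥∥-+ (φ z) (ψ z)) ⟩
    fromℕ m ℝ.* ((p ℝ.+ p) ℝ.+ (q ℝ.+ q))
      ≈⟨ solveℝ 3 (λ m p q → m ⊗ ((p ⊕ p) ⊕ (q ⊕ q)) ⊜ (m ⊕ m) ⊗ p ⊕ (m ⊕ m) ⊗ q)
           ℝ.refl (fromℕ m) p q ⟩
    (fromℕ m ℝ.+ fromℕ m) ℝ.* p ℝ.+ (fromℕ m ℝ.+ fromℕ m) ℝ.* q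
      <⟨ ℝ.x+x<1∧y+y<1⇒x+y<1
           (ℝ.<-respˡ-≈ (quadruple p) (boundφ z (ℝ.x<1/[m+n]⇒x<1/m nφ nψ (∥∥-nonnegative _) near)))
           (ℝ.<-respˡ-≈ (quadruple q) (boundψ z (ℝ.x<1/[m+n]⇒x<1/n nφ nψ (∥∥-nonnegative _) near))) ⟩
    ℝ.1# ∎
    where
    open ℝ.≤-Reasoning
    4m nφ nψ : ℕ
    -- `∥∥-+` doubles each norm, and each of the two contributions must stay below one half.
    4m = (m ℕ.+ m) ℕ.+ (m ℕ.+ m)
    nφ = proj₁ (vφ 4m)
    nψ = proj₁ (vψ 4m)
    boundφ = proj₂ (vφ 4m)
    boundψ = proj₂ (vψ 4m)
    quadruple : ∀ p → fromℕ 4m ℝ.* p ℝ.≈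
      (fromℕ m ℝ.+ fromℕ m) ℝ.* p ℝ.+ (fromℕ m ℝ.+ fromℕ m) ℝ.* p
    quadruple p = ℝ.trans (ℝ.*-congʳ (ℝ.trans (ℝ.fromℕ-homo-+ (m ℕ.+ m) (m ℕ.+ m))
      (ℝ.+-cong (ℝ.fromℕ-homo-+ m m) (ℝ.fromℕ-homo-+ m m)))) (ℝ.distribʳ p _ _)

  -- One factor need only be bounded, here by 1; the other supplies the smallness.
  vanishing-* : ∀ {a φ ψ} → Vanishing a φ → Vanishing a ψ → Vanishing a (λ z → φ z * ψ z)
  vanishing-* {a} {φ} {ψ} vφ vψ m = nφ ℕ.+ nψ , λ z near →
    let near-φ = ℝ.x<1/[m+n]⇒x<1/m nφ nψ (∥∥-nonnegative _) near
        near-ψ = ℝ.x<1/[m+n]⇒x<1/n nφ nψ (∥∥-nonnegative _) near in begin-strict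
    fromℕ m ℝ.* ∥ φ z * ψ z ∥
      ≈⟨ ℝ.*-congˡ (∥∥-homo-* (φ z) (ψ z)) ⟩
    fromℕ m ℝ.* (∥ φ z ∥ ℝ.* ∥ ψ z ∥)
      ≈⟨ solveℝ 3 (λ m p q → m ⊗ (p ⊗ q) ⊜ (𝟙 ⊕ 𝟘) ⊗ p ⊗ (m ⊗ q))
           ℝ.refl (fromℕ m) ∥ φ z ∥ ∥ ψ z ∥ ⟩
    fromℕ 1 ℝ.* ∥ φ z ∥ ℝ.* (fromℕ m ℝ.* ∥ ψ z ∥)
      ≤⟨ ℝ.*-mono-≤ (ℝ.*-nonnegative (ℝ.0≤fromℕ 1) (∥∥-nonnegative _))
           (ℝ.*-nonnegative (ℝ.0≤fromℕ m) (∥∥-nonnegative _))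
           (ℝ.<⇒≤ (proj₂ (vφ 1) z near-φ)) (ℝ.<-irrefl ℝ.refl) ⟩
    ℝ.1# ℝ.* (fromℕ m ℝ.* ∥ ψ z ∥)
      ≈⟨ ℝ.*-identityˡ _ ⟩
    fromℕ m ℝ.* ∥ ψ z ∥
      <⟨ proj₂ (vψ m) z near-ψ ⟩
    ℝ.1# ∎
    where
    open ℝ.≤-Reasoning
    nφ nψ : ℕ
    nφ = proj₁ (vφ 1)
    nψ = proj₁ (vψ m)

  vanishing-scale : ∀ b {a φ} → Vanishing a φ → Vanishing a (λ z → b * φ z)
  vanishing-scale b {a} {φ} vφ m = proj₁ (vφ (m ℕ.* k)) , λ z near → begin-strict
    fromℕ m ℝ.* ∥ b * φ z ∥
      ≈⟨ ℝ.*-congˡ (∥∥-homo-* b (φ z)) ⟩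
    fromℕ m ℝ.* (∥ b ∥ ℝ.* ∥ φ z ∥)
      ≤⟨ ℝ.*-monoˡ-≤ (ℝ.0≤fromℕ m) (ℝ.*-mono-≤ (∥∥-nonnegative b) (∥∥-nonnegative _)
           (ℝ.<⇒≤ (proj₂ (ℝ.archimedean ∥ b ∥))) (ℝ.<-irrefl ℝ.refl)) ⟩
    fromℕ m ℝ.* (fromℕ k ℝ.* ∥ φ z ∥)
      ≈⟨ ℝ.*-assoc _ _ _ ⟨
    fromℕ m ℝ.* fromℕ k ℝ.* ∥ φ z ∥
      ≈⟨ ℝ.*-congʳ (ℝ.fromℕ-homo-* m k) ⟨
    fromℕ (m ℕ.* k) ℝ.* ∥ φ z ∥
      <⟨ proj₂ (vφ (m ℕ.* k)) z near ⟩
    ℝ.1# ∎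
    where
    open ℝ.≤-Reasoning
    k : ℕ
    k = proj₁ (ℝ.archimedean ∥ b ∥)

  ContinuousAt : X → (X → Carrier) → Set (ℓ₃ ⊔ x)
  ContinuousAt a f = Vanishing a (λ z → f z - f a)

  continuous-resp : ∀ {a f g} → (∀ z → f z ≈ g z) → ContinuousAt a f → ContinuousAt a g
  continuous-resp {a} f≈g = vanishing-resp (λ z → +-cong (f≈g z) (-‿cong (f≈g a)))

  continuous-const : ∀ {a} b → ContinuousAt a (λ _ → b)
  continuous-const b m = 0 , λ z _ → ℝ.<-respˡ-≈
    (ℝ.sym (ℝ.trans (ℝ.*-congˡ (ℝ.trans (∥∥-cong (-‿inverseʳ b)) ∥0∥≈0)) (ℝ.zeroʳ _))) ℝ.0<1

  continuous-ι : ∀ {a} → ContinuousAt a ι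
  continuous-ι m = m , λ z near → near

  continuous-+ : ∀ {a f g} → ContinuousAt a f → ContinuousAt a g → ContinuousAt a (λ z → f z + g z)
  continuous-+ {a} {f} {g} cf cg = vanishing-resp
    (λ z → solve 4 (λ f f₀ g g₀ → f :- f₀ :+ (g :- g₀) := f :+ g :- (f₀ :+ g₀)) refl
      (f z) (f a) (g z) (g a))
    (vanishing-+ cf cg)

  continuous-* : ∀ {a f g} → ContinuousAt a f → ContinuousAt a g → ContinuousAt a (λ z → f z * g z)
  continuous-* {a} {f} {g} cf cg = vanishing-resp
    (λ z → solve 4 (λ f f₀ g g₀ →
        (f :- f₀) :* (g :- g₀) :+ (f₀ :* (g :- g₀) :+ g₀ :* (f :- f₀)) := f :* g :- f₀ :* g₀) refl
      (f z) (f a) (g z) (g a))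
    (vanishing-+ (vanishing-* cf cg) (vanishing-+ (vanishing-scale (f a) cg) (vanishing-scale (g a) cf)))

  -- By `cleared`, `U * ∥ t z - t a ∥` equals `d * T`, so the claim reduces to `e < U`. No lower
  -- bound for `U` is computed: `1 ≤ 2 T (d + U)` follows from `t a * u a ≈ 1`, and `n` is chosen to
  -- give `2 T (d + e) < 1`; cancelling `2 T` and `d` leaves `e < U`.
  continuous-reciprocal : ∀ {a u t} → (∀ z → u z * t z ≈ 1#) → ContinuousAt a u → ContinuousAt a t
  continuous-reciprocal {a} {u} {t} ut≈1 cu m = proj₁ (cu n) , λ z near →
    let d = ∥ u z - u a ∥
        U = ∥ u z ∥
        e = fromℕ m ℝ.* (d ℝ.* T)
        0≤d = ∥∥-nonnegative (u z - u a)
        0≤e : ℝ.0# ≤ e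
        0≤e = ℝ.*-nonnegative (ℝ.0≤fromℕ m) (ℝ.*-nonnegative 0≤d 0≤T)
        T[d+e]<1 : (T ℝ.+ T) ℝ.* (d ℝ.+ e) < ℝ.1#
        T[d+e]<1 = begin-strict
          (T ℝ.+ T) ℝ.* (d ℝ.+ e)
            ≤⟨ ℝ.*-mono-≤ (ℝ.+-nonnegative 0≤T 0≤T)
                 (ℝ.+-nonnegative 0≤d (ℝ.*-nonnegative (ℝ.0≤fromℕ m) (ℝ.*-nonnegative 0≤d (ℝ.0≤fromℕ k))))
                 T+T≤k+k (ℝ.+-monoʳ-≤ d (ℝ.*-monoˡ-≤ (ℝ.0≤fromℕ m) (ℝ.*-monoˡ-≤ 0≤d T≤k))) ⟩
          (fromℕ k ℝ.+ fromℕ k) ℝ.* (d ℝ.+ fromℕ m ℝ.* (d ℝ.* fromℕ k))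
            ≈⟨ solveℝ 3 (λ k d m → 
                 (k ⊕ k) ⊗ (d ⊕ m ⊗ (d ⊗ k)) ⊜ (k ⊕ k) ⊗ (𝟙 ⊕ m ⊗ k) ⊗ d)
               ℝ.refl (fromℕ k) d (fromℕ m) ⟩
          (fromℕ k ℝ.+ fromℕ k) ℝ.* (ℝ.1# ℝ.+ fromℕ m ℝ.* fromℕ k) ℝ.* d
            ≈⟨ ℝ.*-congʳ (ℝ.trans (ℝ.fromℕ-homo-* (k ℕ.+ k) (suc (m ℕ.* k)))
                 (ℝ.*-cong (ℝ.fromℕ-homo-+ k k) (ℝ.+-congˡ (ℝ.fromℕ-homo-* m k)))) ⟨
          fromℕ n ℝ.* d
            <⟨ proj₂ (cu n) z near ⟩
          ℝ.1# ∎
        1≤T[d+U] : ℝ.1# ≤ (T ℝ.+ T) ℝ.* (d ℝ.+ U)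
        1≤T[d+U] = begin
          ℝ.1#
            ≈⟨ ∥1∥≈1 ⟨
          ∥ 1# ∥
            ≈⟨ ∥∥-cong (trans (*-comm _ _) (ut≈1 a)) ⟨
          ∥ t a * u a ∥
            ≈⟨ ∥∥-homo-* _ _ ⟩
          T ℝ.* ∥ u a ∥
            ≈⟨ ℝ.*-congˡ (∥∥-cong (solve 2 (λ x y → y := x :+ :- (x :- y)) refl (u z) (u a))) ⟩
          T ℝ.* ∥ u z + - (u z - u a) ∥
            ≤⟨ ℝ.*-monoˡ-≤ 0≤T (∥∥-+ _ _) ⟩
          T ℝ.* ((U ℝ.+ U) ℝ.+ (∥ - (u z - u a) ∥ ℝ.+ ∥ - (u z - u a) ∥))
            ≈⟨ ℝ.*-congˡ (ℝ.+-congˡ (ℝ.+-cong (∥-∥ _) (∥-∥ _))) ⟩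
          T ℝ.* ((U ℝ.+ U) ℝ.+ (d ℝ.+ d))
            ≈⟨ solveℝ 3 (λ T U d → 
                 T ⊗ ((U ⊕ U) ⊕ (d ⊕ d)) ⊜ (T ⊕ T) ⊗ (d ⊕ U)) ℝ.refl T U d ⟩
          (T ℝ.+ T) ℝ.* (d ℝ.+ U) ∎
        d+e<d+U : d ℝ.+ e < d ℝ.+ U
        d+e<d+U = ℝ.*-cancelˡ-< (ℝ.+-nonnegative 0≤T 0≤T) (ℝ.<-≤-trans T[d+e]<1 1≤T[d+U])
        e<U : e < U
        e<U = begin-strict
          e                    ≈⟨ solveℝ 2 (λ d e → e ⊜ ⊝ d ⊕ (d ⊕ e)) ℝ.refl d e ⟩
          ℝ.- d ℝ.+ (d ℝ.+ e)  <⟨ ℝ.+-monoʳ-< (ℝ.- d) d+e<d+U ⟩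
          ℝ.- d ℝ.+ (d ℝ.+ U)  ≈⟨ solveℝ 2 (λ d e → e ⊜ ⊝ d ⊕ (d ⊕ e)) ℝ.refl d U ⟨
          U                    ∎
    in ℝ.*-cancelˡ-< (ℝ.<⇒≤ (ℝ.≤-<-trans 0≤e e<U)) (begin-strict
      U ℝ.* (fromℕ m ℝ.* ∥ t z - t a ∥)
        ≈⟨ solveℝ 3 (λ U m d → U ⊗ (m ⊗ d) ⊜ m ⊗ (U ⊗ d)) ℝ.refl U (fromℕ m) _ ⟩
      fromℕ m ℝ.* (U ℝ.* ∥ t z - t a ∥)
        ≈⟨ ℝ.*-congˡ (ℝ.trans (ℝ.sym (∥∥-homo-* _ _)) (ℝ.trans (∥∥-cong (cleared z))
             (ℝ.trans (∥-∥ _) (∥∥-homo-* _ _)))) ⟩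
      e
        <⟨ e<U ⟩
      U
        ≈⟨ ℝ.*-identityʳ U ⟨
      U ℝ.* ℝ.1# ∎)
    where
    open ℝ.≤-Reasoning
    T : ℝ.Carrier
    T = ∥ t a ∥
    k n : ℕ
    k = proj₁ (ℝ.archimedean T)
    -- From `2 T (d + e) = 2 T (1 + m T) d`, with the natural bound `k` in place of `T`.
    n = (k ℕ.+ k) ℕ.* suc (m ℕ.* k)
    0≤T : ℝ.0# ≤ T
    0≤T = ∥∥-nonnegative (t a)
    T≤k : T ≤ fromℕ k
    T≤k = ℝ.<⇒≤ (proj₂ (ℝ.archimedean T))
    T+T≤k+k : T ℝ.+ T ≤ fromℕ k ℝ.+ fromℕ k
    T+T≤k+k = begin
      T ℝ.+ T              ≤⟨ ℝ.+-monoʳ-≤ T T≤k ⟩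
      T ℝ.+ fromℕ k        ≤⟨ ℝ.+-monoˡ-≤ (fromℕ k) T≤k ⟩
      fromℕ k ℝ.+ fromℕ k  ∎
    cleared : ∀ z → u z * (t z - t a) ≈ - ((u z - u a) * t a)
    cleared z = trans
      (solve 3 (λ u t t₀ → u :* (t :- t₀) := u :* t :- u :* t₀) refl (u z) (t z) (t a))
      (trans (+-congʳ (trans (ut≈1 z) (sym (ut≈1 a))))
        (solve 3 (λ u u₀ t₀ → u₀ :* t₀ :- u :* t₀ := :- ((u :- u₀) :* t₀)) refl (u z) (u a) (t a)))

  -- Carathéodory's form of the derivative: the product rule then needs no ε-δ
  -- argument beyond the continuity of products.
  infix 4 _↦_
  _↦_ : Rel (X → Carrier) (c′ ⊔ ℓ′ ⊔ ℓ₃ ⊔ x)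
  f ↦ f′ = ∀ a → ∃ λ φ → ContinuousAt a φ × φ a ≈ f′ a ×
    (∀ z → f z - f a ≈ (ι z - ι a) * φ z)

  ↦⇒continuous : ∀ {f f′} → f ↦ f′ → ∀ a → ContinuousAt a f
  ↦⇒continuous {f} f↦ a with f↦ a
  ... | φ , cφ , _ , slope = continuous-resp
    (λ z → trans (+-congˡ (sym (slope z))) (solve 2 (λ x y → y :+ (x :- y) := x) refl (f z) (f a)))
    (continuous-+ (continuous-const (f a))
      (continuous-* (continuous-+ continuous-ι (continuous-const (- ι a))) cφ))

  isDerivation : IsDerivation R _↦_
  isDerivation = record
    { ↦-resp = λ f≈f₁ g≈g₁ f↦g a → let φ , cφ , φa , slope = f↦g a in
        φ , cφ , trans φa (g≈g₁ a) ,
        λ z → trans (sym (+-cong (f≈f₁ z) (-‿cong (f≈f₁ a)))) (slope z)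
    ; ↦-const = λ b a → (λ _ → 0#) , continuous-const 0# , refl ,
        λ z → trans (-‿inverseʳ b) (sym (zeroʳ _))
    ; ↦-+ = λ {f} {_} {g} f↦ g↦ a →
        let φ , cφ , φa , slope-f = f↦ a
            ψ , cψ , ψa , slope-g = g↦ a in
        (λ z → φ z + ψ z) , continuous-+ cφ cψ , +-cong φa ψa , λ z → trans
          (solve 4 (λ f f₀ g g₀ → f :+ g :- (f₀ :+ g₀) := f :- f₀ :+ (g :- g₀)) refl
            (f z) (f a) (g z) (g a))
          (trans (+-cong (slope-f z) (slope-g z)) (sym (distribˡ _ _ _)))
    ; ↦-* = λ {f} {_} {g} f↦ g↦ a →
        let φ , cφ , φa , slope-f = f↦ a
            ψ , cψ , ψa , slope-g = g↦ a in
        -- The increment is split as `(f z - f a) * g z + f a * (g z - g a)`; since `g` is taken at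
        -- the moving point, its continuity is needed.
        (λ z → φ z * g z + f a * ψ z) ,
        continuous-+ (continuous-* cφ (↦⇒continuous g↦ a)) (continuous-* (continuous-const (f a)) cψ) ,
        +-cong (*-congʳ φa) (*-congˡ ψa) ,
        λ z → trans
          (solve 4 (λ f f₀ g g₀ → f :* g :- f₀ :* g₀ := (f :- f₀) :* g :+ f₀ :* (g :- g₀)) refl
            (f z) (f a) (g z) (g a))
          (trans (+-cong (*-congʳ (slope-f z)) (*-congˡ (slope-g z)))
            (solve 5 (λ d φ g f₀ ψ → d :* φ :* g :+ f₀ :* (d :* ψ) := d :* (φ :* g :+ f₀ :* ψ)) refl
              (ι z - ι a) (φ z) (g z) (f a) (ψ z)))
    }

  ι↦ : ∀ b → (λ z → ι z - b) ↦ λ _ → 1#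
  ι↦ b a = (λ _ → 1#) , continuous-const 1# , refl , λ z →
    solve 3 (λ z a b → z :- b :- (a :- b) := (z :- a) :* :1) refl (ι z) (ι a) b

  -- The slope `- t a * t z` is exact for all `z`, which leaves only the continuity of `t` to
  -- analysis.
  reciprocal↦ : ∀ b {t} → (∀ z → (ι z - b) * t z ≈ 1#) → t ↦ λ z → - (t z * t z)
  reciprocal↦ b {t} ut≈1 a = (λ z → - t a * t z) ,
    continuous-* (continuous-const (- t a))
      (continuous-reciprocal ut≈1 (↦⇒continuous (ι↦ b) a)) ,
    solve 1 (λ t → :- t :* t := :- (t :* t)) refl (t a) ,
    λ z → begin
      t z - t a
        ≈⟨ +-cong (trans (sym (*-identityʳ _)) (*-congˡ (sym (ut≈1 a))))
                  (-‿cong (trans (sym (*-identityʳ _)) (*-congˡ (sym (ut≈1 z))))) ⟩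
      t z * ((ι a - b) * t a) - t a * ((ι z - b) * t z)
        ≈⟨ solve 5 (λ z a b t t₀ → t :* ((a :- b) :* t₀) :- t₀ :* ((z :- b) :* t)
                                := (z :- a) :* (:- t₀ :* t)) refl (ι z) (ι a) b (t z) (t a) ⟩
      (ι z - ι a) * (- t a * t z) ∎
    where open SetoidReasoning setoid

-- The closed form for a harmonic quadruple

module FieldProperties {c ℓ₁ ℓ₂} (F : HeytingField c ℓ₁ ℓ₂) where

  open FieldOperations F
  open CommutativeSemiringExp commutativeSemiring using (^-distrib-*; ^-congˡ)
  open SetoidReasoning setoid

  1^n≈1 : ∀ n → 1# ^ n ≈ 1#
  1^n≈1 zero    = refl
  1^n≈1 (suc n) = trans (*-identityˡ _) (1^n≈1 n)

  x^n*y^n≈1 : ∀ {x y} → x * y ≈ 1# → ∀ n → x ^ n * y ^ n ≈ 1#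
  x^n*y^n≈1 {x} {y} xy≈1 n = trans (sym (^-distrib-* x y n)) (trans (^-congˡ n xy≈1) (1^n≈1 n))

  -- `inverse` takes an apartness proof; uniqueness makes inverses obtained from different proofs
  -- comparable.
  inverse-unique : ∀ x (x#0 : x # 0#) {y} → x * y ≈ 1# → inverse x x#0 ≈ y
  inverse-unique x x#0 {y} xy≈1 = begin
    inverse x x#0              ≈⟨ *-identityʳ _ ⟨
    inverse x x#0 * 1#         ≈⟨ *-congˡ xy≈1 ⟨
    inverse x x#0 * (x * y)    ≈⟨ *-assoc _ _ _ ⟨
    inverse x x#0 * x * y      ≈⟨ *-congʳ (trans (*-comm _ _) (inverseʳ x x#0)) ⟩
    1# * y                     ≈⟨ *-identityˡ y ⟩
    y                          ∎

  inverse-^ : ∀ x (x#0 : x # 0#) n (x^n#0 : x ^ n # 0#) → inverse (x ^ n) x^n#0 ≈ inverse x x#0 ^ n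
  inverse-^ x x#0 n x^n#0 = inverse-unique (x ^ n) x^n#0 (x^n*y^n≈1 (inverseʳ x x#0) n)

  module HarmonicQuadruple
    (α β γ δ : Carrier) (α#β : α # β)
    (harmonic : (α + β) * (γ + δ) ≈ fromℕ 2 * (α * β + γ * δ)) where

    open CommutativeSemiringExp commutativeSemiring using (^-assocʳ; ^-congʳ)
    open IntegerCoefficients commutativeRing using (solve; _:+_; _:*_; :-_; _:-_; _:=_; :0; :1)

    -- Points carry their apartness proofs, so that partial functions become the total ones on which
    -- derivations act.
    Domain : Set (c ⊔ ℓ₂)
    Domain = ∃ (_# β)

    u t : Domain → Carrier
    u (k , k#β) = k - β
    t (k , k#β) = inverse (k - β) (x#y⇒x-y#0 k#β)

    ut≈1 : ∀ k → u k * t k ≈ 1#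
    ut≈1 (k , k#β) = inverseʳ (k - β) (x#y⇒x-y#0 k#β)

    private
      a : Domain
      a = α , α#β

      τ s q κ : Carrier
      τ = t a
      s = (β - γ) + (β - δ)
      q = (β - γ) * (β - δ)
      κ = 1# + s * τ + q * (τ * τ)

    open QuadraticPower commutativeRing κ q

    -- `τ` is the critical point of `1 + s t + q t²`: as `(α - β) * τ ≈ 1#`, the left side is `τ`
    -- times `s (α - β) + 2 q`, which expands to the difference of the two sides of `harmonic`.
    s+2qτ≈0 : s + (1# + 1#) * q * τ ≈ 0#
    s+2qτ≈0 = begin
      s + (1# + 1#) * q * τ
        ≈⟨ +-congʳ (trans (sym (*-identityʳ s)) (*-congˡ (sym (ut≈1 a)))) ⟩
      s * ((α - β) * τ) + (1# + 1#) * q * τ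
        ≈⟨ solve 5 (λ α β γ δ τ →
             (β :- γ :+ (β :- δ)) :* ((α :- β) :* τ) :+ (:1 :+ :1) :* ((β :- γ) :* (β :- δ)) :* τ
             := ((:1 :+ (:1 :+ :0)) :* (α :* β :+ γ :* δ) :- (α :+ β) :* (γ :+ δ)) :* τ) refl α β γ δ τ ⟩
      (fromℕ 2 * (α * β + γ * δ) - (α + β) * (γ + δ)) * τ
        ≈⟨ *-congʳ (trans (+-congˡ (-‿cong harmonic)) (-‿inverseʳ _)) ⟩
      0# * τ
        ≈⟨ zeroˡ τ ⟩
      0# ∎

    -- In the Taylor expansion of the product about `τ`, the constant term is `κ` and the linear
    -- coefficient is `s + 2 q τ`, which vanishes.
    completed-square : ∀ t → κ + q * ((t - τ) * (t - τ)) ≈ (1# + (β - γ) * t) * (1# + (β - δ) * t)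
    completed-square t = begin
      κ + q * ((t - τ) * (t - τ))
        ≈⟨ +-identityʳ _ ⟨
      κ + q * ((t - τ) * (t - τ)) + 0#
        ≈⟨ +-congˡ (trans (*-congʳ s+2qτ≈0) (zeroˡ _)) ⟨
      κ + q * ((t - τ) * (t - τ)) + (s + (1# + 1#) * q * τ) * (t - τ)
        ≈⟨ solve 4 (λ b d t τ → let s = b :+ d ; q = b :* d in
             (:1 :+ s :* τ :+ q :* (τ :* τ)) :+ q :* ((t :- τ) :* (t :- τ))
               :+ (s :+ (:1 :+ :1) :* q :* τ) :* (t :- τ)
             := (:1 :+ b :* t) :* (:1 :+ d :* t)) refl (β - γ) (β - δ) t τ ⟩
      (1# + (β - γ) * t) * (1# + (β - δ) * t) ∎

    -- Identically, `4 q κ = 4 q - s² + (s + 2 q τ)²`, and `s² - 4 q` is the square of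
    -- `(β - γ) - (β - δ)`. The right side is spelled as an unfolded `(γ - δ) ^ 2`.
    4qκ : fromℕ 4 * (q * κ) ≈ - 1# * ((γ - δ) * ((γ - δ) * 1#))
    4qκ = begin
      fromℕ 4 * (q * κ)
        ≈⟨ solve 4 (λ β γ δ τ → let s = (β :- γ) :+ (β :- δ) ; q = (β :- γ) :* (β :- δ)
                                    e = s :+ (:1 :+ :1) :* q :* τ in
             (:1 :+ (:1 :+ (:1 :+ (:1 :+ :0)))) :* (q :* (:1 :+ s :* τ :+ q :* (τ :* τ)))
             := :- :1 :* ((γ :- δ) :* ((γ :- δ) :* :1)) :+ e :* e) refl β γ δ τ ⟩
      - 1# * ((γ - δ) * ((γ - δ) * 1#)) + (s + (1# + 1#) * q * τ) * (s + (1# + 1#) * q * τ)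
        ≈⟨ +-congˡ (trans (*-congʳ s+2qτ≈0) (zeroˡ _)) ⟩
      - 1# * ((γ - δ) * ((γ - δ) * 1#)) + 0#
        ≈⟨ +-identityʳ _ ⟩
      - 1# * ((γ - δ) * ((γ - δ) * 1#)) ∎

    quotient : ℕ → Domain → Carrier
    quotient n (k , k#β) =
      ((k - γ) ^ n * (k - δ) ^ n) / (k - β) ^ (n ℕ.+ 1) ⟨ x^n#0 (x#y⇒x-y#0 k#β) (n ℕ.+ 1) ⟩

    nthDerivative : ℕ → Domain → Carrier
    nthDerivative n x = (- 1#) ^ n * (t x ^ suc n * derivative n n (t x - τ))

    module _ {d} {_↦_ : Rel (Domain → Carrier) d} (isDerivation : IsDerivation commutativeRing _↦_)
             (u↦ : u ↦ λ _ → 1#) (t↦ : t ↦ λ x → - (t x * t x)) where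

      open IsDerivation isDerivation
      open Iteration commutativeRing isDerivation
      open Reciprocal u t ut≈1 u↦ t↦

      quotient≈ : ∀ n x → u^[ n -1] x * derivative n 0 (t x - τ) ≈ quotient n x
      quotient≈ n x@(k , k#β) = begin
        u^[ n -1] x * (κ + q * ((t x - τ) * (t x - τ))) ^ n
          -- Writing `u ^ (n - 1)` as `u ^ n * t` lets `u ^ n` cancel one of the two `t ^ n` to
          -- come, so that `t ^ suc n` remains.
          ≈⟨ *-cong (u^n*t n x) (^-congˡ n factor) ⟨
        u x ^ n * t x * ((k - γ) * (k - δ) * (t x * t x)) ^ n
          ≈⟨ *-congˡ (trans (^-distrib-* _ _ n) (*-cong (^-distrib-* _ _ n) (^-distrib-* _ _ n))) ⟩
        u x ^ n * t x * ((k - γ) ^ n * (k - δ) ^ n * (t x ^ n * t x ^ n))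
          ≈⟨ solve 4 (λ U t f T → U :* t :* (f :* (T :* T)) := f :* (U :* T) :* (t :* T)) refl
               (u x ^ n) (t x) ((k - γ) ^ n * (k - δ) ^ n) (t x ^ n) ⟩
        (k - γ) ^ n * (k - δ) ^ n * (u x ^ n * t x ^ n) * (t x ^ suc n)
          ≈⟨ *-cong (trans (*-congˡ (x^n*y^n≈1 (ut≈1 x) n)) (*-identityʳ _))
                    (^-congʳ (t x) (ℕ.+-comm 1 n)) ⟩
        (k - γ) ^ n * (k - δ) ^ n * t x ^ (n ℕ.+ 1)
          ≈⟨ *-congˡ (inverse-^ (k - β) (x#y⇒x-y#0 k#β) (n ℕ.+ 1) _) ⟨
        quotient n x ∎
        where
        linear : ∀ c → (k - c) * t x ≈ 1# + (β - c) * t x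
        linear c = trans (solve 4 (λ k b c t → (k :- c) :* t := (k :- b) :* t :+ (b :- c) :* t) refl k β c (t x))
          (+-congʳ (ut≈1 x))
        factor : (k - γ) * (k - δ) * (t x * t x) ≈ κ + q * ((t x - τ) * (t x - τ))
        factor = trans (solve 3 (λ c d t → c :* d :* (t :* t) := c :* t :* (d :* t)) refl _ _ _)
          (trans (*-cong (linear γ) (linear δ)) (sym (completed-square (t x))))

      iterated-quotient : ∀ n → Iterated n (quotient n) (nthDerivative n)
      iterated-quotient n = iterated-resp (quotient≈ n) (λ _ → refl)
        (bol n (λ k x → derivative n k (t x - τ)) (derivative↦ isDerivation h↦ n))
        where
        h↦ : (λ x → t x - τ) ↦ λ x → - (t x * t x)
        h↦ = ↦-resp (λ _ → refl) (λ _ → +-identityʳ _) (↦-+ t↦ (↦-const (- τ)))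

      -- Serves the continuity of the n-th derivative, for which any `f′` will do; unification finds
      -- it.
      nthDerivative↦ : ∀ n → ∃ λ f′ → nthDerivative n ↦ f′
      nthDerivative↦ n = _ , ↦-* (↦-const _) (↦-* (t^n↦ (suc n))
        (derivative↦ isDerivation (↦-+ t↦ (↦-const (- τ))) n n))

    nthDerivative-odd : ∀ n → 2 ∤ n → nthDerivative n a ≈ 0#
    nthDerivative-odd n 2∤n = trans
      (*-congˡ (trans (*-congˡ (derivative-odd (-‿inverseʳ τ) n n 2∤n)) (zeroʳ _))) (zeroʳ _)

    nthDerivative-even : ∀ n → 2 ∣ n → nthDerivative n a ≈
      (- 1#) ^ (n ℕ./ 2)
        * ((γ - δ) ^ n / (α - β) ^ (n ℕ.+ 1) ⟨ x^n#0 (x#y⇒x-y#0 α#β) (n ℕ.+ 1) ⟩)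
        * fromℕ (oddSquares (n ℕ./ 2))
    nthDerivative-even n (divides m ≡.refl) rewrite m*n/n≡m m 2 {{_}} | ℕ.*-comm m 2 = begin
      (- 1#) ^ (2 ℕ.* m) * (τ ^ suc (2 ℕ.* m) * derivative (2 ℕ.* m) (2 ℕ.* m) (τ - τ))
        ≈⟨ *-cong sign (*-cong (^-congʳ τ (ℕ.+-comm 1 (2 ℕ.* m)))
             (trans (derivative-diagonal (-‿inverseʳ τ) m) (*-congʳ (trans (^-congˡ m 4qκ)
               (trans (^-distrib-* _ _ m) (*-congˡ (^-assocʳ _ 2 m))))))) ⟩
      1# * (τ ^ (2 ℕ.* m ℕ.+ 1) * ((- 1#) ^ m * (γ - δ) ^ (2 ℕ.* m) * fromℕ (oddSquares m)))
        ≈⟨ solve 4 (λ T s g o → :1 :* (T :* (s :* g :* o)) := s :* (g :* T) :* o) refl _ _ _ _ ⟩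
      (- 1#) ^ m * ((γ - δ) ^ (2 ℕ.* m) * τ ^ (2 ℕ.* m ℕ.+ 1)) * fromℕ (oddSquares m)
        ≈⟨ *-congʳ (*-congˡ (*-congˡ (inverse-^ (α - β) (x#y⇒x-y#0 α#β) (2 ℕ.* m ℕ.+ 1) _))) ⟨
      (- 1#) ^ m
        * ((γ - δ) ^ (2 ℕ.* m) / (α - β) ^ (2 ℕ.* m ℕ.+ 1) ⟨ x^n#0 (x#y⇒x-y#0 α#β) (2 ℕ.* m ℕ.+ 1) ⟩)
        * fromℕ (oddSquares m) ∎
      where
      -- Bol's sign is trivial at even order; the `(- 1#) ^ m` of the result stems from `4qκ`.
      sign : (- 1#) ^ (2 ℕ.* m) ≈ 1#
      sign = trans (sym (^-assocʳ (- 1#) 2 m))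
        (trans (^-congˡ m (solve 0 (:- :1 :* (:- :1 :* :1) := :1) refl)) (1^n≈1 m))

-- From Carathéodory derivatives to ε-δ limits in ℂ

module ComplexDerivatives {c ℓ₁ ℓ₂ ℓ₃} (ℝ : RealField c ℓ₁ ℓ₂ ℓ₃) where

  private
    module ℝ where
      open RealField ℝ public
      open OrderProperties ℝ public
  open ComplexAnalysis ℝ

  module _ where
    open IntegerCoefficients ℝ.commutativeRing using (solve; _:+_; _:*_; :-_; _:-_; _:=_; :0; :1)
    open ℝ.≤-Reasoning

    ∣∣²-nonnegative : ∀ z → ℝ.0# ℝ.≤ ∣ z ∣²
    ∣∣²-nonnegative z = ℝ.+-nonnegative (ℝ.0≤xx (re z)) (ℝ.0≤xx (im z))

    isSquaredNorm : IsSquaredNorm ℝ commutativeRing ∣_∣²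
    isSquaredNorm = record
      { ∥∥-cong = λ (p , q) → ℝ.+-cong (ℝ.*-cong p p) (ℝ.*-cong q q)
      ; ∥∥-nonnegative = ∣∣²-nonnegative
      ; ∥0∥≈0 = solve 0 (:0 :* :0 :+ :0 :* :0 := :0) ℝ.refl
      ; ∥1∥≈1 = solve 0 (:1 :* :1 :+ :0 :* :0 := :1) ℝ.refl
      ; ∥-∥ = λ z → solve 2 (λ a b → :- a :* :- a :+ :- b :* :- b := a :* a :+ b :* b) ℝ.refl (re z) (im z)
      ; ∥∥-homo-* = λ z w → solve 4 (λ a b c d →
          (a :* c :- b :* d) :* (a :* c :- b :* d) :+ (a :* d :+ b :* c) :* (a :* d :+ b :* c)
          := (a :* a :+ b :* b) :* (c :* c :+ d :* d)) ℝ.refl (re z) (im z) (re w) (im w)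
      -- The parallelogram law: `∣ z + w ∣²` and `∣ z - w ∣²` add up to `S`.
      ; ∥∥-+ = λ z w → let
            S = (∣ z ∣² ℝ.+ ∣ z ∣²) ℝ.+ (∣ w ∣² ℝ.+ ∣ w ∣²)
            x = re z ℝ.- re w
            y = im z ℝ.- im w in begin
          ∣ z + w ∣²
            ≈⟨ ℝ.+-identityʳ _ ⟨
          ∣ z + w ∣² ℝ.+ ℝ.0#
            ≤⟨ ℝ.+-monoʳ-≤ _ (ℝ.+-nonnegative (ℝ.0≤xx x) (ℝ.0≤xx y)) ⟩
          ∣ z + w ∣² ℝ.+ (x ℝ.* x ℝ.+ y ℝ.* y)
            ≈⟨ solve 4 (λ a b c d → let n = a :* a :+ b :* b ; m = c :* c :+ d :* d in
                 (a :+ c) :* (a :+ c) :+ (b :+ d) :* (b :+ d)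
                   :+ ((a :- c) :* (a :- c) :+ (b :- d) :* (b :- d))
                 := (n :+ n) :+ (m :+ m)) ℝ.refl (re z) (im z) (re w) (im w) ⟩
          S ∎
      }

  module _ {p} (D : ℂ → Set p) where

    private
      ι : ∃ D → ℂ
      ι = proj₁

    open Continuity ℝ commutativeRing isSquaredNorm ι public
    open Iteration commutativeRing isDerivation public using (Iterated; base; step)
    open IsSquaredNorm isSquaredNorm using (∥∥-cong)

    continuous⇒limit : ∀ {f a l} (a∈D : D a) → ContinuousAt (a , a∈D) f → f (a , a∈D) ≈ l →
                       Limit D (λ z z∈D → f (z , z∈D)) a l
    continuous⇒limit {f} {a} {l} a∈D cf fa≈l ε 0<ε =
      let m , small = ℝ.1/n<εε ε 0<ε
          n , bound = cf m
          δ , 0<δ , near = ℝ.δδ<1/n n in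
      δ , 0<δ , λ z z∈D _ z-a<δ → small (ℝ.<-respˡ-≈
        (ℝ.*-congˡ (∥∥-cong {f (z , z∈D) - f (a , a∈D)} {f (z , z∈D) - l}
          (+-congˡ {f (z , z∈D)} (-‿cong {f (a , a∈D)} {l} fa≈l))))
        (bound (z , z∈D) (near (∣∣²-nonnegative (z - a)) z-a<δ)))

    -- Away from `z` the Carathéodory slope is the difference quotient, so its continuity at `z` is
    -- the required limit.
    ↦⇒derivative : ∀ {f f′} → f ↦ f′ →
      Derivative D (λ z z∈D → f (z , z∈D)) (λ z z∈D → f′ (z , z∈D))
    ↦⇒derivative {f} {f′} f↦ z z∈D ε 0<ε =
      let φ , cφ , φz≈ , slope = f↦ (z , z∈D)
          m , small = ℝ.1/n<εε ε 0<ε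
          n , bound = cφ m
          δ , 0<δ , near = ℝ.δδ<1/n n in
      δ , 0<δ , λ w (w∈D , w#z) _ w-z<δ → small (ℝ.<-respˡ-≈
        (ℝ.*-congˡ (∥∥-cong
          {φ (w , w∈D) - φ (z , z∈D)}
          {differenceQuotient D (λ z z∈D → f (z , z∈D)) z z∈D w (w∈D , w#z) - f′ (z , z∈D)}
          (+-cong (sym (quotient≈φ φ slope w w∈D w#z)) (-‿cong φz≈))))
        (bound (w , w∈D) (near (∣∣²-nonnegative (w - z)) w-z<δ)))
      where
      open IntegerCoefficients commutativeRing using (solve; _:*_; _:=_)
      quotient≈φ : ∀ φ → (∀ x → f x - f (z , z∈D) ≈ (ι x - z) * φ x) → ∀ w w∈D w#z →
        differenceQuotient D (λ z z∈D → f (z , z∈D)) z z∈D w (w∈D , w#z) ≈ φ (w , w∈D)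
      quotient≈φ φ slope w w∈D w#z = begin
        (f (w , w∈D) - f (z , z∈D)) * i   ≈⟨ *-congʳ (slope (w , w∈D)) ⟩
        (w - z) * φ (w , w∈D) * i         ≈⟨ solve 3 (λ d φ i → d :* φ :* i := d :* i :* φ) refl (w - z) (φ (w , w∈D)) i ⟩
        (w - z) * i * φ (w , w∈D)         ≈⟨ *-congʳ (inverseʳ (w - z) (x#y⇒x-y#0 w#z)) ⟩
        1# * φ (w , w∈D)                  ≈⟨ *-identityˡ (φ (w , w∈D)) ⟩
        φ (w , w∈D)                       ∎
        where
        open SetoidReasoning setoid
        i : ℂ
        i = inverse (w - z) (x#y⇒x-y#0 w#z)

    iterated⇒nthDerivative : ∀ {n f g} → Iterated n f g →
      NthDerivative D n (λ z z∈D → f (z , z∈D)) (λ z z∈D → g (z , z∈D))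
    iterated⇒nthDerivative (base f≈g)  = base (λ z z∈D → f≈g (z , z∈D))
    iterated⇒nthDerivative (step f↦ i) = step (↦⇒derivative f↦) (iterated⇒nthDerivative i)

theorem7 : ∀ {c ℓ₁ ℓ₂ ℓ₃} (ℝ : RealField c ℓ₁ ℓ₂ ℓ₃) → let open ComplexAnalysis ℝ in
    (n : ℕ) → 1 ℕ.≤ n →
    (α β γ δ : ℂ) (α#β : α # β) → α # γ → α # δ → β # γ → β # δ → γ # δ →
    (α + β) * (γ + δ) ≈ fromℕ 2 * (α * β + γ * δ) →
    ∃ λ (g : Function (_# β)) →
    NthDerivative (_# β) n
    (λ k k#β → ((k - γ) ^ n * (k - δ) ^ n)
    / (k - β) ^ (n ℕ.+ 1) ⟨ x^n#0 (x#y⇒x-y#0 k#β) (n ℕ.+ 1) ⟩) g ×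
    (2 ∤ n → Limit (_# β) g α 0#) ×
    (2 ∣ n → Limit (_# β) g α
    ((- 1#) ^ (n ℕ./ 2)
    * ((γ - δ) ^ n / (α - β) ^ (n ℕ.+ 1) ⟨ x^n#0 (x#y⇒x-y#0 α#β) (n ℕ.+ 1) ⟩)
    * fromℕ (product (map (λ i → (2 ℕ.* i ℕ.∸ 1) ℕ.^ 2) (applyUpTo ℕ.suc (n ℕ./ 2))))))
theorem7 ℝ n _ α β γ δ α#β _ _ _ _ _ harmonic =
  (λ k k#β → nthDerivative n (k , k#β)) ,
  iterated⇒nthDerivative (_# β) (iterated-quotient isDerivation′ (ι↦ (_# β) β) t↦ n) ,
  (λ 2∤n → continuous⇒limit (_# β) α#β continuous (nthDerivative-odd n 2∤n)) ,
  (λ 2∣n → continuous⇒limit (_# β) α#β continuous (nthDerivative-even n 2∣n))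
  where
  open ComplexAnalysis ℝ
  open ComplexDerivatives ℝ
  open FieldProperties.HarmonicQuadruple heytingField α β γ δ α#β harmonic
  isDerivation′ = isDerivation (_# β)
  t↦ = reciprocal↦ (_# β) β ut≈1
  continuous : ContinuousAt (_# β) (α , α#β) (nthDerivative n)
  -- One derivative beyond the n-th gives continuity at α, so both limits are values of the closed
  -- form.
  continuous = ↦⇒continuous (_# β) (proj₂ (nthDerivative↦ isDerivation′ (ι↦ (_# β) β) t↦ n)) (α , α#β)
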